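{- Let $M$ be a matroid of rank $2$ on $[n]$. Let $l$ be the number of loops of $M$, let $p$ be the number of parallel classes of $M$ of size at least $2$, and for each integer $k\ge 2$ let $n_k$ be the number of parallel classes of $M$ of size $k$. Then $$\mathbbm{1}(\mathcal{P}(M))=(1-p)\,\mathbbm{1}(\mathcal{P}(S(l+1,l+2)))+\sum_{k=2}^{n-1} n_k\,\mathbbm{1}(\mathcal{P}(S(l+1,l+k+1))).$$
   Context: A loop is an element of rank $0$; a parallel class of $M$ is a set $F\setminus L(M)$ where $F$ is a flat of rank $1$ and $L(M)$ is the set of loops. For $1\le x_1<x_2\le n$, $S(x_1,x_2)$ is the Schubert matroid of rank $2$ on $[n]$ whose bases are the $2$-subsets $\{b_1<b_2\}$ of $[n]$ with $b_1\ge x_1$, $b_2\ge x_2$. The base polytope $\mathcal{P}(M)\subset\mathbb{R}^n$ is the convex hull of the indicator vectors $\sum_{i\in B}e_i$ of the bases $B$ of $M$. For $X\subseteq\mathbb{R}^n$, the symmetrized indicator function is $\mathbbm{1}(X)(x)=\frac{1}{n!}\sum_{\sigma\in S_n}\overline{\mathbbm{1}}(X)(\sigma(x))$, where $\overline{\mathbbm{1}}(X)$ is the ordinary indicator function of $X$ and $S_n$ acts by permuting coordinates.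
   Formalization: The identity of symmetrized indicator functions is stated at points of ℚ^n instead of ℝ^n, with base polytopes taken as convex hulls with rational coefficients. -}

module Defs where

open import Data.Bool using (Bool; true; false; T; _∧_; _∨_; not; if_then_else_)
open import Data.Nat as ℕ using (ℕ; zero; suc; _⊔_; _<ᵇ_; _≤ᵇ_; _≡ᵇ_; _!)
open import Data.Nat.Properties using (_!≢0)
open import Data.Fin as Fin using (Fin; toℕ)
open import Data.Fin.Subset using (Subset; _∩_; _∪_; _─_; ⁅_⁆; ∣_∣; ⊥)
open import Data.Vec as Vec using (Vec; []; _∷_)
open import Data.List as List using (List; []; _∷_; _++_; map; filterᵇ; length; concatMap; allFin; upTo; foldr)
open import Data.Bool.ListAction using (all; any)
open import Data.Integer as ℤ using (ℤ; +_)
open import Data.Rational as ℚ using (ℚ; 0ℚ; 1ℚ; _+_; _*_; _≤_)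
open import Data.Product using (Σ; _×_)
open import Relation.Binary.PropositionalEquality using (_≡_)
open import Relation.Nullary using (Dec; yes; no)

-- Finite enumerations (ground set [n] is modelled by Fin n; element
-- i : Fin n stands for the integer toℕ i + 1).

allSubsets : (n : ℕ) → List (Subset n)
allSubsets zero    = Vec.[] ∷ []
allSubsets (suc n) = concatMap (λ s → (false ∷ s) ∷ (true ∷ s) ∷ []) (allSubsets n)

memᵇ : ∀ {n} → Fin n → Subset n → Bool
memᵇ i s = Vec.lookup s i

finEqᵇ : ∀ {n} → Fin n → Fin n → Bool
finEqᵇ i j = toℕ i ≡ᵇ toℕ j

subsetEqᵇ : ∀ {n} → Subset n → Subset n → Bool
subsetEqᵇ {n} s t = all (λ i → eqB (memᵇ i s) (memᵇ i t)) (allFin n)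
  where
  eqB : Bool → Bool → Bool
  eqB true  b = b
  eqB false b = not b

allVecs : (n k : ℕ) → List (Vec (Fin n) k)
allVecs n zero    = Vec.[] ∷ []
allVecs n (suc k) = concatMap (λ v → map (λ i → i ∷ v) (allFin n)) (allVecs n k)

injectiveᵇ : ∀ {n k} → Vec (Fin n) k → Bool
injectiveᵇ []       = true
injectiveᵇ (i ∷ v)  = not (any (finEqᵇ i) (Vec.toList v)) ∧ injectiveᵇ v

-- the symmetric group S_n, each permutation listed exactly once,
-- as the injective maps Fin n → Fin n (given by their value tables)
permutations : (n : ℕ) → List (Fin n → Fin n)
permutations n = map Vec.lookup (filterᵇ injectiveᵇ (allVecs n n))

record Matroid (n : ℕ) : Set where
  field
    isBase   : Subset n → Bool
    nonempty : Σ (Subset n) (λ B → T (isBase B))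
    exchange : ∀ B₁ B₂ → T (isBase B₁) → T (isBase B₂) →
               ∀ x → T (memᵇ x B₁) → T (not (memᵇ x B₂)) →
               Σ (Fin n) (λ y → T (memᵇ y B₂) × T (not (memᵇ y B₁)) ×
                                T (isBase ((B₁ ─ ⁅ x ⁆) ∪ ⁅ y ⁆)))

module _ {n : ℕ} (M : Matroid n) where
  open Matroid M

  bases : List (Subset n)
  bases = filterᵇ isBase (allSubsets n)

  rank : Subset n → ℕ
  rank S = foldr (λ B r → ∣ S ∩ B ∣ ⊔ r) 0 (bases)

  HasRank2 : Set
  HasRank2 = ∀ B → T (isBase B) → ∣ B ∣ ≡ 2

  isLoopᵇ : Fin n → Bool
  isLoopᵇ i = rank ⁅ i ⁆ ≡ᵇ 0

  loops : Subset n
  loops = Vec.map isLoopᵇ (Vec.allFin n)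

  numLoops : ℕ
  numLoops = ∣ loops ∣

  isFlatᵇ : Subset n → Bool
  isFlatᵇ F = all (λ i → memᵇ i F ∨ (rank F <ᵇ rank (F ∪ ⁅ i ⁆))) (allFin n)

  isParallelClassᵇ : Subset n → Bool
  isParallelClassᵇ P =
    any (λ F → isFlatᵇ F ∧ (rank F ≡ᵇ 1) ∧ subsetEqᵇ (F ─ loops) P) (allSubsets n)

  parallelClasses : List (Subset n)
  parallelClasses = filterᵇ isParallelClassᵇ (allSubsets n)

  numBigClasses : ℕ
  numBigClasses = length (filterᵇ (λ P → 2 ≤ᵇ ∣ P ∣) parallelClasses)

  numClasses : ℕ → ℕ
  numClasses k = length (filterᵇ (λ P → ∣ P ∣ ≡ᵇ k) parallelClasses)

Point : ℕ → Set
Point n = Fin n → ℚ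

sumℚ : List ℚ → ℚ
sumℚ = foldr _+_ 0ℚ

sumFin : ∀ {m} → (Fin m → ℚ) → ℚ
sumFin {zero}  f = 0ℚ
sumFin {suc m} f = f Fin.zero + sumFin (λ j → f (Fin.suc j))

_∈Hull_ : ∀ {n} → Point n → List (Point n) → Set
_∈Hull_ {n} y V =
  Σ (Fin (length V) → ℚ) λ c →
    (∀ j → 0ℚ ≤ c j) ×
    (sumFin c ≡ 1ℚ) ×
    (∀ i → sumFin (λ j → c j * List.lookup V j i) ≡ y i)

bool→ℚ : Bool → ℚ
bool→ℚ true  = 1ℚ
bool→ℚ false = 0ℚ

indicatorVec : ∀ {n} → Subset n → Point n
indicatorVec B i = bool→ℚ (memᵇ i B)

-- vertex list of the base polytope P(M)
basePolytope : ∀ {n} → Matroid n → List (Point n)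
basePolytope M = map indicatorVec (bases M)

-- bases of the Schubert matroid S(x₁,x₂) of rank 2 on [n]:
-- {b₁ < b₂} with b₁ ≥ x₁, b₂ ≥ x₂ (element i : Fin n is the integer toℕ i + 1)
schubertBases : (n x₁ x₂ : ℕ) → List (Subset n)
schubertBases n x₁ x₂ =
  concatMap (λ i → map (λ j → ⁅ i ⁆ ∪ ⁅ j ⁆)
                      (filterᵇ (λ j → (toℕ i <ᵇ toℕ j) ∧ (x₁ ≤ᵇ suc (toℕ i)) ∧ (x₂ ≤ᵇ suc (toℕ j)))
                               (allFin n)))
            (allFin n)

schubertPolytope : (n x₁ x₂ : ℕ) → List (Point n)
schubertPolytope n x₁ x₂ = map indicatorVec (schubertBases n x₁ x₂)

-- Indicator functions.  Membership in a convex hull is not definitionally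
-- decidable, so the indicator is computed from a decision procedure for
-- membership (any such procedure gives the same 0/1 value).

HullDecider : ℕ → Set
HullDecider n = (V : List (Point n)) (y : Point n) → Dec (y ∈Hull V)

indicator : ∀ {n} → HullDecider n → List (Point n) → Point n → ℚ
indicator dec V y with dec V y
... | yes _ = 1ℚ
... | no  _ = 0ℚ

act : ∀ {n} → (Fin n → Fin n) → Point n → Point n
act σ x i = x (σ i)

symIndicator : ∀ {n} → HullDecider n → List (Point n) → Point n → ℚ
symIndicator {n} dec V x =
  ((+ 1) ℚ./ (n !)) {{n !≢0}} * sumℚ (map (λ σ → indicator dec V (act σ x)) (permutations n))

ℕ→ℚ : ℕ → ℚ
ℕ→ℚ k = (+ k) ℚ./ 1

{-# OPTIONS --safe #-}
-- A point y ≥ 0 of total mass 2, vanishing on the loops and with all entries at most 1, lies in P(M) exactly when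
-- every parallel class carries mass at most 1.  Two disjoint sets cannot both carry mass more than 1, so
-- 1(P(M)) = 1(Δ) − Σ_P (1(Δ) − 1(Δ ∩ {y(P) ≤ 1})), the sum running over the classes P with |P| ≥ 2 and Δ being the
-- hypersimplex on the nonloops.  Up to a permutation of coordinates, Δ ∩ {y(P) ≤ 1} is P(S(l+1, l+|P|+1)), and Δ is
-- the case |P| = 1; symmetrization forgets the permutation.
module Submission where

open import Defs
open import Data.Nat using (ℕ; _+_; _∸_)
open import Data.List using (map; upTo)
open import Data.Rational using (ℚ; 1ℚ; _-_; _*_)
open import Relation.Binary.PropositionalEquality using (_≡_)

import Algebra.Properties.CommutativeMonoid.Sum as Sum
open import Data.Bool using (Bool; true; false; T; _∧_; _∨_; not; if_then_else_)
open import Data.Bool.ListAction using (all; any)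
open import Data.Bool.Properties using (T-∧; T-∨; T?)
open import Data.Empty using (⊥)
open import Data.Fin as Fin using (Fin; toℕ)
open import Data.Fin.Permutation as Perm using (Permutation′; _⟨$⟩ʳ_; _⟨$⟩ˡ_; _∘ₚ_)
import Data.Fin.Properties as FinP
open import Data.Fin.Subset using (Subset; _∪_; _∩_; _─_; ⁅_⁆; ∣_∣; _⊆_; Nonempty) renaming (_∈_ to _∈ₛ_; _∉_ to _∉ₛ_)
import Data.Fin.Subset.Properties as SubsetP
import Data.Integer as ℤ
import Data.Integer.Properties as ℤP
open import Data.List using (List; []; _∷_; length; lookup; filterᵇ; foldr; concatMap; allFin)
open import Data.List.Membership.Propositional using (_∈_; find; lose)
open import Data.List.Membership.Propositional.Properties
  using (∈-lookup; ∈-map⁺; ∈-map⁻; ∈-filter⁺; ∈-filter⁻; ∈-concatMap⁺; ∈-concatMap⁻; ∈-allFin; ∈-upTo⁺)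
open import Data.List.Membership.Propositional.Properties.WithK using (unique∧set⇒bag)
import Data.List.Properties as ListP
open import Data.List.Relation.Binary.BagAndSetEquality using (∼bag⇒↭)
open import Data.List.Relation.Binary.Permutation.Propositional as ↭ using (_↭_)
import Data.List.Relation.Binary.Permutation.Propositional.Properties as ↭P
open import Data.List.Relation.Unary.All as All using (All; []; _∷_)
open import Data.List.Relation.Unary.All.Properties as AllP using (all⁺; all⁻; ¬All⇒Any¬)
open import Data.List.Relation.Unary.AllPairs as AllPairs using (AllPairs; []; _∷_)
import Data.List.Relation.Unary.AllPairs.Properties as AllPairsP
open import Data.List.Relation.Unary.Any using (here; there)
open import Data.List.Relation.Unary.Any.Properties using (any⁺; any⁻)
open import Data.List.Relation.Unary.Unique.Propositional using (Unique)
import Data.List.Relation.Unary.Unique.Propositional.Properties as UniqueP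
open import Data.Nat as ℕ using (zero; suc; _⊔_; _<ᵇ_; _≤ᵇ_; _≡ᵇ_)
open import Data.Nat.Coprimality as Coprimality using (Coprime)
import Data.Nat.Properties as ℕP
open import Data.Product using (Σ; _×_; _,_; proj₁; proj₂; ∃)
open import Data.Rational as ℚ using (0ℚ) renaming (_+_ to _+ℚ_; _≤_ to _≤ℚ_; _<_ to _<ℚ_)
import Data.Rational.Properties as ℚP
open import Data.Sum using (_⊎_; inj₁; inj₂; [_,_]′; map₁)
open import Data.Unit using (tt)
open import Data.Vec as Vec using ([]; _∷_)
import Data.Vec.Properties as VecP
open import Function using (_∘_; Equivalence; mk⇔; _⇔_)
open import Relation.Binary.Definitions using (tri<; tri≈; tri>)
open import Relation.Binary.PropositionalEquality
  using (_≢_; refl; sym; trans; cong; cong₂; subst; subst₂; module ≡-Reasoning)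
open import Relation.Nullary using (¬_; Dec; yes; no; does; contradiction)
open import Relation.Nullary.Decidable using (dec⇒maybe; decidable-stable; map′; _×-dec_; _→-dec_)
open import Tactic.RingSolver using (solve-∀)
open import Tactic.RingSolver.Core.AlmostCommutativeRing using (AlmostCommutativeRing; fromCommutativeRing)

-- Membership in a hull asks for coefficients, whereas the inclusion-exclusion compares
-- inequalities, so every polytope is first traded for a system of linear inequalities. One
-- statement covers M and all Schubert matroids: in each case the bases are the pairs of nonloops
-- with different labels, for a suitable labelling (`PairsAcross`). The hard direction is from the
-- inequalities back to coefficients, since weights must be found on pairs across arbitrarily many
-- classes. It is reduced to three groups of classes, and between two groups the product of the two
-- mass distributions serves as the weight. The inequalities are decidable over the rationals, so
-- the identity of indicators is checked point by point, whichever `dec` is given. For the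
-- symmetrization, a cut is recorded as a colouring of the ground set by three colours; sorting the
-- colouring supplies the permutation that leads to a Schubert matroid.

module ∑ = Sum ℚP.+-0-commutativeMonoid

-- Arithmetic and inequalities of rationals

ℚ-ring : AlmostCommutativeRing _ _
ℚ-ring = fromCommutativeRing ℚP.+-*-commutativeRing (λ x → dec⇒maybe (0ℚ ℚP.≟ x))

+-interchange : ∀ a b c d → (a +ℚ b) +ℚ (c +ℚ d) ≡ (a +ℚ c) +ℚ (b +ℚ d)
+-interchange = solve-∀ ℚ-ring

*-exchange : ∀ a b c → a * (b * c) ≡ b * (a * c)
*-exchange = solve-∀ ℚ-ring

2ℚ : ℚ
2ℚ = 1ℚ +ℚ 1ℚ

≤-offset : ∀ {a b} d → 0ℚ ≤ℚ d → b ≡ a +ℚ d → a ≤ℚ b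
≤-offset {a} {b} d 0≤d eq = begin
  a         ≡⟨ ℚP.+-identityʳ a ⟨
  a +ℚ 0ℚ   ≤⟨ ℚP.+-monoʳ-≤ a 0≤d ⟩
  a +ℚ d    ≡⟨ eq ⟨
  b         ∎
  where open ℚP.≤-Reasoning

0≤- : ∀ {a b} → a ≤ℚ b → 0ℚ ≤ℚ b - a
0≤- {a} {b} a≤b = begin
  0ℚ       ≡⟨ ℚP.+-inverseʳ a ⟨
  a - a    ≤⟨ ℚP.+-monoˡ-≤ (ℚ.- a) a≤b ⟩
  b - a    ∎
  where open ℚP.≤-Reasoning

+-nonneg : ∀ {a b} → 0ℚ ≤ℚ a → 0ℚ ≤ℚ b → 0ℚ ≤ℚ a +ℚ b
+-nonneg {a} {b} p q = subst (_≤ℚ a +ℚ b) (ℚP.+-identityˡ 0ℚ) (ℚP.+-mono-≤ p q)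

*-mono-≤ˡ : ∀ {a b c} → 0ℚ ≤ℚ c → a ≤ℚ b → c * a ≤ℚ c * b
*-mono-≤ˡ {c = c} 0≤c = ℚP.*-monoˡ-≤-nonNeg c {{ℚ.nonNegative 0≤c}}

*-nonneg : ∀ {a b} → 0ℚ ≤ℚ a → 0ℚ ≤ℚ b → 0ℚ ≤ℚ a * b
*-nonneg {a} {b} p q = subst (_≤ℚ a * b) (ℚP.*-zeroʳ a) (*-mono-≤ˡ p q)

-- Finite sums

sumFin-cong : ∀ {m} {f g : Fin m → ℚ} → (∀ i → f i ≡ g i) → sumFin f ≡ sumFin g
sumFin-cong {zero}  h = refl
sumFin-cong {suc m} h = cong₂ _+ℚ_ (h Fin.zero) (sumFin-cong (h ∘ Fin.suc))

sumFin-0 : ∀ {m} (f : Fin m → ℚ) → (∀ i → f i ≡ 0ℚ) → sumFin f ≡ 0ℚ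
sumFin-0 {zero}  f h = refl
sumFin-0 {suc m} f h = trans (cong₂ _+ℚ_ (h Fin.zero) (sumFin-0 (f ∘ Fin.suc) (h ∘ Fin.suc))) (ℚP.+-identityˡ 0ℚ)

sumFin-+ : ∀ {m} (f g : Fin m → ℚ) → sumFin (λ i → f i +ℚ g i) ≡ sumFin f +ℚ sumFin g
sumFin-+ {zero}  f g = sym (ℚP.+-identityˡ 0ℚ)
sumFin-+ {suc m} f g = trans (cong (f Fin.zero +ℚ g Fin.zero +ℚ_) (sumFin-+ (f ∘ Fin.suc) (g ∘ Fin.suc)))
                             (+-interchange (f Fin.zero) (g Fin.zero) _ _)

*-sumFin : ∀ {m} c (f : Fin m → ℚ) → c * sumFin f ≡ sumFin (λ i → c * f i)
*-sumFin {zero}  c f = ℚP.*-zeroʳ c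
*-sumFin {suc m} c f = trans (ℚP.*-distribˡ-+ c _ _) (cong (c * f Fin.zero +ℚ_) (*-sumFin c (f ∘ Fin.suc)))

sumFin-comm : ∀ {m n} (f : Fin m → Fin n → ℚ) →
  sumFin (λ i → sumFin (f i)) ≡ sumFin (λ j → sumFin (λ i → f i j))
sumFin-comm {zero}  {n} f = sym (sumFin-0 {n} (λ _ → 0ℚ) (λ _ → refl))
sumFin-comm {suc m} {n} f = trans (cong (sumFin (f Fin.zero) +ℚ_) (sumFin-comm (f ∘ Fin.suc)))
                                  (sym (sumFin-+ (f Fin.zero) (λ j → sumFin (λ i → f (Fin.suc i) j))))

sumFin-mono : ∀ {m} {f g : Fin m → ℚ} → (∀ i → f i ≤ℚ g i) → sumFin f ≤ℚ sumFin g
sumFin-mono {zero}  h = ℚP.≤-refl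
sumFin-mono {suc m} h = ℚP.+-mono-≤ (h Fin.zero) (sumFin-mono (h ∘ Fin.suc))

sumFin-nonneg : ∀ {m} {f : Fin m → ℚ} → (∀ i → 0ℚ ≤ℚ f i) → 0ℚ ≤ℚ sumFin f
sumFin-nonneg {m} {f} h = subst (_≤ℚ sumFin f) (sumFin-0 {m} (λ _ → 0ℚ) (λ _ → refl)) (sumFin-mono h)

sumFin-single : ∀ {m} (f : Fin m → ℚ) k → (∀ i → i ≢ k → f i ≡ 0ℚ) → sumFin f ≡ f k
sumFin-single f Fin.zero h =
  trans (cong (f Fin.zero +ℚ_) (sumFin-0 (f ∘ Fin.suc) (λ i → h (Fin.suc i) (λ ())))) (ℚP.+-identityʳ _)
sumFin-single f (Fin.suc k) h =
  trans (cong₂ _+ℚ_ (h Fin.zero (λ ()))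
                   (sumFin-single (f ∘ Fin.suc) k (λ i i≢k → h (Fin.suc i) (λ { refl → i≢k refl }))))
        (ℚP.+-identityˡ _)

term≤sumFin : ∀ {m} (f : Fin m → ℚ) → (∀ i → 0ℚ ≤ℚ f i) → ∀ k → f k ≤ℚ sumFin f
term≤sumFin f h Fin.zero    = ≤-offset _ (sumFin-nonneg (h ∘ Fin.suc)) refl
term≤sumFin f h (Fin.suc k) =
  ℚP.≤-trans (term≤sumFin (f ∘ Fin.suc) (h ∘ Fin.suc) k)
             (≤-offset (f Fin.zero) (h Fin.zero) (ℚP.+-comm (f Fin.zero) _))

-- Cones over finite point sets

-- The homogenized hull: the total weight `t` is a parameter, so partial combinations can be added
-- and scaled, and only the final one has to have weight 1.
record InCone {n} (V : List (Point n)) (t : ℚ) (y : Point n) : Set where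
  constructor inCone
  field
    coeff  : Fin (length V) → ℚ
    nonneg : ∀ j → 0ℚ ≤ℚ coeff j
    total  : sumFin coeff ≡ t
    combo  : ∀ i → sumFin (λ j → coeff j * lookup V j i) ≡ y i

module _ {n} {V : List (Point n)} where

  cone-resp : ∀ {s t y z} → s ≡ t → (∀ i → y i ≡ z i) → InCone V s y → InCone V t z
  cone-resp refl y≗z (inCone c c≥0 c-tot c-comb) = inCone c c≥0 c-tot (λ i → trans (c-comb i) (y≗z i))

  cone-zero : InCone V 0ℚ (λ _ → 0ℚ)
  cone-zero = inCone (λ _ → 0ℚ) (λ _ → ℚP.≤-refl) (sumFin-0 {length V} _ (λ _ → refl))
                     (λ i → sumFin-0 {length V} _ (λ j → ℚP.*-zeroˡ (lookup V j i)))

  cone-+ : ∀ {s t y z} → InCone V s y → InCone V t z → InCone V (s +ℚ t) (λ i → y i +ℚ z i)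
  cone-+ (inCone c c≥0 c-tot c-comb) (inCone d d≥0 d-tot d-comb) = inCone
    (λ j → c j +ℚ d j)
    (λ j → +-nonneg (c≥0 j) (d≥0 j))
    (trans (sumFin-+ c d) (cong₂ _+ℚ_ c-tot d-tot))
    (λ i → trans (sumFin-cong (λ j → ℚP.*-distribʳ-+ (lookup V j i) (c j) (d j)))
             (trans (sumFin-+ (λ j → c j * lookup V j i) (λ j → d j * lookup V j i))
                    (cong₂ _+ℚ_ (c-comb i) (d-comb i))))

  cone-* : ∀ {r t y} → 0ℚ ≤ℚ r → InCone V t y → InCone V (r * t) (λ i → r * y i)
  cone-* {r} 0≤r (inCone c c≥0 c-tot c-comb) = inCone
    (λ j → r * c j)
    (λ j → *-nonneg 0≤r (c≥0 j))
    (trans (sym (*-sumFin r c)) (cong (r *_) c-tot))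
    (λ i → trans (sumFin-cong (λ j → ℚP.*-assoc r (c j) _))
             (trans (sym (*-sumFin r (λ j → c j * lookup V j i))) (cong (r *_) (c-comb i))))

  cone-∑ : ∀ {m} {t : Fin m → ℚ} {y : Fin m → Point n} →
    (∀ k → InCone V (t k) (y k)) → InCone V (sumFin t) (λ i → sumFin (λ k → y k i))
  cone-∑ {zero}  h = cone-zero
  cone-∑ {suc m} h = cone-+ (h Fin.zero) (cone-∑ (h ∘ Fin.suc))

cone-vertex : ∀ {n} {V : List (Point n)} {v} → v ∈ V → InCone V 1ℚ v
cone-vertex {V = v ∷ V} (here refl) = inCone c c≥0 tot comb
  where
  c : Fin (suc (length V)) → ℚ
  c Fin.zero    = 1ℚ
  c (Fin.suc _) = 0ℚ
  c≥0 : ∀ j → 0ℚ ≤ℚ c j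
  c≥0 Fin.zero    = ℚP.nonNegative⁻¹ 1ℚ
  c≥0 (Fin.suc _) = ℚP.≤-refl
  c-off : ∀ j → j ≢ Fin.zero → c j ≡ 0ℚ
  c-off Fin.zero    j≢0 = contradiction refl j≢0
  c-off (Fin.suc j) _   = refl
  tot = sumFin-single c Fin.zero c-off
  comb : ∀ i → sumFin (λ j → c j * lookup (v ∷ V) j i) ≡ v i
  comb i = trans (sumFin-single (λ j → c j * lookup (v ∷ V) j i) Fin.zero
                   (λ j j≢0 → trans (cong (_* lookup (v ∷ V) j i) (c-off j j≢0)) (ℚP.*-zeroˡ (lookup (v ∷ V) j i))))
                 (ℚP.*-identityˡ (v i))
cone-vertex {V = u ∷ V} {v} (there v∈V) = inCone d d≥0 tot comb
  where
  open InCone (cone-vertex {V = V} v∈V)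
  d : Fin (suc (length V)) → ℚ
  d Fin.zero    = 0ℚ
  d (Fin.suc j) = coeff j
  d≥0 : ∀ j → 0ℚ ≤ℚ d j
  d≥0 Fin.zero    = ℚP.≤-refl
  d≥0 (Fin.suc j) = nonneg j
  tot : sumFin d ≡ 1ℚ
  tot = trans (ℚP.+-identityˡ _) total
  comb : ∀ i → sumFin (λ j → d j * lookup (u ∷ V) j i) ≡ v i
  comb i = trans (cong₂ _+ℚ_ (ℚP.*-zeroˡ (u i)) (combo i)) (ℚP.+-identityˡ _)

cone⇒hull : ∀ {n} {V : List (Point n)} {y} → InCone V 1ℚ y → y ∈Hull V
cone⇒hull (inCone c c≥0 c-tot c-comb) = c , c≥0 , c-tot , c-comb

-- Linear functionals on hulls

⟨_,_⟩ : ∀ {n} → (Fin n → ℚ) → Point n → ℚ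
⟨ w , y ⟩ = sumFin (λ i → w i * y i)

module _ {n} (V : List (Point n)) {y : Point n} (y∈ : y ∈Hull V) where

  private
    c     = proj₁ y∈
    c≥0   = proj₁ (proj₂ y∈)
    c-tot = proj₁ (proj₂ (proj₂ y∈))
    c-com = proj₂ (proj₂ (proj₂ y∈))

  ⟨⟩-hull : ∀ w → ⟨ w , y ⟩ ≡ sumFin (λ j → c j * ⟨ w , lookup V j ⟩)
  ⟨⟩-hull w = begin
    sumFin (λ i → w i * y i)
      ≡⟨ sumFin-cong (λ i → trans (cong (w i *_) (sym (c-com i))) (*-sumFin (w i) (λ j → c j * lookup V j i))) ⟩
    sumFin (λ i → sumFin (λ j → w i * (c j * lookup V j i)))
      ≡⟨ sumFin-comm (λ i j → w i * (c j * lookup V j i)) ⟩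
    sumFin (λ j → sumFin (λ i → w i * (c j * lookup V j i)))
      ≡⟨ sumFin-cong (λ j → trans (sumFin-cong (λ i → *-exchange (w i) (c j) (lookup V j i)))
                                  (sym (*-sumFin (c j) (λ i → w i * lookup V j i)))) ⟩
    sumFin (λ j → c j * ⟨ w , lookup V j ⟩) ∎
    where open ≡-Reasoning

  average-const : ∀ r → sumFin (λ j → c j * r) ≡ r
  average-const r = begin
    sumFin (λ j → c j * r)   ≡⟨ sumFin-cong (λ j → ℚP.*-comm (c j) r) ⟩
    sumFin (λ j → r * c j)   ≡⟨ *-sumFin r c ⟨
    r * sumFin c             ≡⟨ cong (r *_) c-tot ⟩
    r * 1ℚ                   ≡⟨ ℚP.*-identityʳ r ⟩
    r                        ∎
    where open ≡-Reasoning

  ⟨⟩-hull-≤ : ∀ w r → (∀ j → ⟨ w , lookup V j ⟩ ≤ℚ r) → ⟨ w , y ⟩ ≤ℚ r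
  ⟨⟩-hull-≤ w r h = subst₂ _≤ℚ_ (sym (⟨⟩-hull w)) (average-const r)
                           (sumFin-mono (λ j → *-mono-≤ˡ (c≥0 j) (h j)))

  ⟨⟩-hull-≡ : ∀ w r → (∀ j → ⟨ w , lookup V j ⟩ ≡ r) → ⟨ w , y ⟩ ≡ r
  ⟨⟩-hull-≡ w r h = trans (⟨⟩-hull w) (trans (sumFin-cong (λ j → cong (c j *_) (h j))) (average-const r))

  hull-nonneg : ∀ i → (∀ j → 0ℚ ≤ℚ lookup V j i) → 0ℚ ≤ℚ y i
  hull-nonneg i h = subst (0ℚ ≤ℚ_) (c-com i) (sumFin-nonneg (λ j → *-nonneg (c≥0 j) (h j)))

  hull-zero : ∀ i → (∀ j → lookup V j i ≡ 0ℚ) → y i ≡ 0ℚ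
  hull-zero i h = trans (sym (c-com i)) (sumFin-0 {length V} _ (λ j → trans (cong (c j *_) (h j)) (ℚP.*-zeroʳ (c j))))

-- Hulls of edge sets of complete multipartite graphs

memᵇ-singleton : ∀ {n} (i : Fin n) → memᵇ i ⁅ i ⁆ ≡ true
memᵇ-singleton Fin.zero    = refl
memᵇ-singleton (Fin.suc i) = memᵇ-singleton i

memᵇ-singleton-≢ : ∀ {n} (i k : Fin n) → i ≢ k → memᵇ k ⁅ i ⁆ ≡ false
memᵇ-singleton-≢ Fin.zero    Fin.zero    i≢k = contradiction refl i≢k
memᵇ-singleton-≢ Fin.zero    (Fin.suc k) _   = VecP.lookup-replicate k false
memᵇ-singleton-≢ (Fin.suc i) Fin.zero    _   = refl
memᵇ-singleton-≢ (Fin.suc i) (Fin.suc k) i≢k = memᵇ-singleton-≢ i k (λ { refl → i≢k refl })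

indicatorVec-pair : ∀ {n} {i j : Fin n} → i ≢ j → ∀ k →
  indicatorVec (⁅ i ⁆ ∪ ⁅ j ⁆) k ≡ indicatorVec ⁅ i ⁆ k +ℚ indicatorVec ⁅ j ⁆ k
indicatorVec-pair {i = i} {j} i≢j k
  rewrite VecP.lookup-zipWith _∨_ k ⁅ i ⁆ ⁅ j ⁆ with i Fin.≟ k
... | yes refl rewrite memᵇ-singleton i | memᵇ-singleton-≢ j i (i≢j ∘ sym) = refl
... | no  i≢k  rewrite memᵇ-singleton-≢ i k i≢k = sym (ℚP.+-identityˡ _)

⟨⟩-singleton : ∀ {n} (w : Fin n → ℚ) i → ⟨ w , indicatorVec ⁅ i ⁆ ⟩ ≡ w i
⟨⟩-singleton w i = begin
  ⟨ w , indicatorVec ⁅ i ⁆ ⟩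
    ≡⟨ sumFin-single (λ k → w k * indicatorVec ⁅ i ⁆ k) i
         (λ k k≢i → trans (cong (λ b → w k * bool→ℚ b) (memᵇ-singleton-≢ i k (k≢i ∘ sym))) (ℚP.*-zeroʳ (w k))) ⟩
  w i * indicatorVec ⁅ i ⁆ i   ≡⟨ cong (λ b → w i * bool→ℚ b) (memᵇ-singleton i) ⟩
  w i * 1ℚ                     ≡⟨ ℚP.*-identityʳ (w i) ⟩
  w i                          ∎
  where open ≡-Reasoning

⟨⟩-pair : ∀ {n} (w : Fin n → ℚ) {i j} → i ≢ j → ⟨ w , indicatorVec (⁅ i ⁆ ∪ ⁅ j ⁆) ⟩ ≡ w i +ℚ w j
⟨⟩-pair w {i} {j} i≢j = begin
  ⟨ w , indicatorVec (⁅ i ⁆ ∪ ⁅ j ⁆) ⟩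
    ≡⟨ sumFin-cong (λ k → trans (cong (w k *_) (indicatorVec-pair i≢j k)) (ℚP.*-distribˡ-+ (w k) _ _)) ⟩
  sumFin (λ k → w k * indicatorVec ⁅ i ⁆ k +ℚ w k * indicatorVec ⁅ j ⁆ k)
    ≡⟨ sumFin-+ (λ k → w k * indicatorVec ⁅ i ⁆ k) (λ k → w k * indicatorVec ⁅ j ⁆ k) ⟩
  ⟨ w , indicatorVec ⁅ i ⁆ ⟩ +ℚ ⟨ w , indicatorVec ⁅ j ⁆ ⟩
    ≡⟨ cong₂ _+ℚ_ (⟨⟩-singleton w i) (⟨⟩-singleton w j) ⟩
  w i +ℚ w j ∎
  where open ≡-Reasoning

mass : ∀ {n} → (Fin n → Bool) → Point n → ℚ
mass A y = ⟨ bool→ℚ ∘ A , y ⟩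

bool→ℚ-nonneg : ∀ b → 0ℚ ≤ℚ bool→ℚ b
bool→ℚ-nonneg true  = ℚP.nonNegative⁻¹ 1ℚ
bool→ℚ-nonneg false = ℚP.≤-refl

⟨1⟩≡sumFin : ∀ {n} (y : Point n) → ⟨ (λ _ → 1ℚ) , y ⟩ ≡ sumFin y
⟨1⟩≡sumFin y = sumFin-cong (λ i → ℚP.*-identityˡ (y i))

-- The classes are the fibres of `f`. The bound runs over all labels, also those of loops and those
-- never attained: loops have entry zero and an empty fibre has mass zero.
record InPartitionPolytope {n} (L : Fin n → Bool) (f : Fin n → ℕ) (y : Point n) : Set where
  field
    nonneg : ∀ i → 0ℚ ≤ℚ y i
    loop   : ∀ i → T (L i) → y i ≡ 0ℚ
    total  : sumFin y ≡ 2ℚ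
    class≤ : ∀ a → mass (λ i → f i ≡ᵇ a) y ≤ℚ 1ℚ

-- `𝓑` is the edge set of the complete multipartite graph on the nonloops whose parts are the fibres
-- of `f`. Only membership is constrained, so order and repetitions in the list do not matter, and a
-- matroid and a Schubert list can both be instances.
record PairsAcross {n} (L : Fin n → Bool) (f : Fin n → ℕ) (𝓑 : List (Subset n)) : Set where
  field
    complete : ∀ {i j} → ¬ T (L i) → ¬ T (L j) → f i ≢ f j → ⁅ i ⁆ ∪ ⁅ j ⁆ ∈ 𝓑
    sound    : ∀ {B} → B ∈ 𝓑 → ∃ λ i → ∃ λ j → ¬ T (L i) × ¬ T (L j) × f i ≢ f j × B ≡ ⁅ i ⁆ ∪ ⁅ j ⁆

-- Indexed by the three test results, so that one match fixes all three booleans at once.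
data Trichotomous : Bool → Bool → Bool → Set where
  <-case : Trichotomous true false false
  ≡-case : Trichotomous false true false
  >-case : Trichotomous false false true

<ᵇ-≡ᵇ-tri : ∀ m a → Trichotomous (m <ᵇ a) (m ≡ᵇ a) (a <ᵇ m)
<ᵇ-≡ᵇ-tri zero    zero    = ≡-case
<ᵇ-≡ᵇ-tri zero    (suc a) = <-case
<ᵇ-≡ᵇ-tri (suc m) zero    = >-case
<ᵇ-≡ᵇ-tri (suc m) (suc a) = <ᵇ-≡ᵇ-tri m a

trichotomous-sum : ∀ {a b c} → Trichotomous a b c → bool→ℚ a +ℚ (bool→ℚ b +ℚ bool→ℚ c) ≡ 1ℚ
trichotomous-sum <-case = refl
trichotomous-sum ≡-case = refl
trichotomous-sum >-case = refl

<ᵇ-suc : ∀ m a → bool→ℚ (m <ᵇ suc a) ≡ bool→ℚ (m <ᵇ a) +ℚ bool→ℚ (m ≡ᵇ a)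
<ᵇ-suc zero    zero    = refl
<ᵇ-suc zero    (suc a) = refl
<ᵇ-suc (suc m) zero    = refl
<ᵇ-suc (suc m) (suc a) = <ᵇ-suc m a

⟨⟩-+ˡ : ∀ {n} (u v : Fin n → ℚ) (y : Point n) → ⟨ (λ i → u i +ℚ v i) , y ⟩ ≡ ⟨ u , y ⟩ +ℚ ⟨ v , y ⟩
⟨⟩-+ˡ u v y = trans (sumFin-cong (λ i → ℚP.*-distribʳ-+ (y i) (u i) (v i)))
                    (sumFin-+ (λ i → u i * y i) (λ i → v i * y i))

⟨⟩-congˡ : ∀ {n} {u v : Fin n → ℚ} (y : Point n) → (∀ i → u i ≡ v i) → ⟨ u , y ⟩ ≡ ⟨ v , y ⟩
⟨⟩-congˡ y u≗v = sumFin-cong (λ i → cong (_* y i) (u≗v i))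

T⇒≡ : ∀ {b} → T b → b ≡ true
T⇒≡ {true} _ = refl

¬T⇒≡ : ∀ {b} → ¬ T b → b ≡ false
¬T⇒≡ {true}  ¬t = contradiction tt ¬t
¬T⇒≡ {false} _  = refl

-- inv 0 = 0
inv : ℚ → ℚ
inv a with a ℚP.≟ 0ℚ
... | yes _   = 0ℚ
... | no  a≢0 = (ℚ.1/ a) {{ℚ.≢-nonZero a≢0}}

inv-nonneg : ∀ {a} → 0ℚ ≤ℚ a → 0ℚ ≤ℚ inv a
inv-nonneg {a} 0≤a with a ℚP.≟ 0ℚ
... | yes _   = ℚP.≤-refl
... | no  a≢0 = ℚP.<⇒≤ (ℚP.positive⁻¹ _ {{ℚP.1/pos⇒pos a {{a>0}}}})
  where
  a>0 : ℚ.Positive a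
  a>0 = ℚP.nonNeg∧nonZero⇒pos a {{ℚ.nonNegative 0≤a}} {{ℚ.≢-nonZero a≢0}}

-- For `a` equal to 0 the two bounds squeeze `t` to 0, which makes the convention for `inv`
-- harmless.
inv-cancel : ∀ {a t} → 0ℚ ≤ℚ t → t ≤ℚ a → t * (a * inv a) ≡ t
inv-cancel {a} {t} 0≤t t≤a with a ℚP.≟ 0ℚ
... | yes refl = trans (cong (t *_) (ℚP.*-zeroʳ a)) (trans (ℚP.*-zeroʳ t) (ℚP.≤-antisym 0≤t t≤a))
... | no  a≢0  = trans (cong (t *_) (ℚP.*-inverseʳ a {{ℚ.≢-nonZero a≢0}})) (ℚP.*-identityʳ t)

sumFin-*-sumFin : ∀ {m n} (u : Fin m → ℚ) (v : Fin n → ℚ) →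
  sumFin (λ i → sumFin (λ j → u i * v j)) ≡ sumFin u * sumFin v
sumFin-*-sumFin u v = begin
  sumFin (λ i → sumFin (λ j → u i * v j))  ≡⟨ sumFin-cong (λ i → trans (sym (*-sumFin (u i) v)) (ℚP.*-comm (u i) _)) ⟩
  sumFin (λ i → sumFin v * u i)            ≡⟨ *-sumFin (sumFin v) u ⟨
  sumFin v * sumFin u                      ≡⟨ ℚP.*-comm (sumFin v) (sumFin u) ⟩
  sumFin u * sumFin v                      ∎
  where open ≡-Reasoning

module _ {n} {L : Fin n → Bool} {f : Fin n → ℕ} {𝓑 : List (Subset n)} (across : PairsAcross L f 𝓑) where
  open PairsAcross across

  private
    V = map indicatorVec 𝓑

    vertex : ∀ j → ∃ λ i → ∃ λ k → ¬ T (L i) × ¬ T (L k) × f i ≢ f k × lookup V j ≡ indicatorVec (⁅ i ⁆ ∪ ⁅ k ⁆)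
    vertex j with ∈-map⁻ indicatorVec (∈-lookup {xs = V} j)
    ... | B , B∈ , eq with sound B∈
    ...   | i , k , ¬Li , ¬Lk , fi≢fk , refl = i , k , ¬Li , ¬Lk , fi≢fk , eq

  hull⇒partitionPolytope : ∀ {y} → y ∈Hull V → InPartitionPolytope L f y
  hull⇒partitionPolytope {y} y∈ = record
    { nonneg = λ i → hull-nonneg V y∈ i (λ j → vertex-nonneg j i)
    ; loop   = λ i Li → hull-zero V y∈ i (λ j → vertex-loop j i Li)
    ; total  = trans (sym (⟨1⟩≡sumFin y)) (⟨⟩-hull-≡ V y∈ (λ _ → 1ℚ) 2ℚ vertex-total)
    ; class≤ = λ a → ⟨⟩-hull-≤ V y∈ (λ i → bool→ℚ (f i ≡ᵇ a)) 1ℚ (vertex-class a)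
    }
    where
    vertex-nonneg : ∀ j i → 0ℚ ≤ℚ lookup V j i
    vertex-nonneg j i with vertex j
    ... | a , b , _ , _ , _ , eq rewrite eq = bool→ℚ-nonneg (memᵇ i (⁅ a ⁆ ∪ ⁅ b ⁆))
    vertex-loop : ∀ j i → T (L i) → lookup V j i ≡ 0ℚ
    vertex-loop j i Li with vertex j
    ... | a , b , ¬La , ¬Lb , fa≢fb , eq rewrite eq = trans
      (indicatorVec-pair (fa≢fb ∘ cong f) i)
      (cong₂ (λ s t → bool→ℚ s +ℚ bool→ℚ t) (memᵇ-singleton-≢ a i (λ { refl → ¬La Li })) (memᵇ-singleton-≢ b i (λ { refl → ¬Lb Li })))
    vertex-total : ∀ j → ⟨ (λ _ → 1ℚ) , lookup V j ⟩ ≡ 2ℚ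
    vertex-total j with vertex j
    ... | a , b , _ , _ , fa≢fb , eq rewrite eq = ⟨⟩-pair (λ _ → 1ℚ) (fa≢fb ∘ cong f)
    vertex-class : ∀ c j → ⟨ (λ i → bool→ℚ (f i ≡ᵇ c)) , lookup V j ⟩ ≤ℚ 1ℚ
    vertex-class c j with vertex j
    ... | a , b , _ , _ , fa≢fb , eq rewrite eq | ⟨⟩-pair (λ i → bool→ℚ (f i ≡ᵇ c)) (fa≢fb ∘ cong f) =
      bound (f a ≡ᵇ c) (f b ≡ᵇ c) (λ p q → fa≢fb (trans (ℕP.≡ᵇ⇒≡ _ _ p) (sym (ℕP.≡ᵇ⇒≡ _ _ q))))
      where
      bound : ∀ s t → (T s → T t → ⊥) → bool→ℚ s +ℚ bool→ℚ t ≤ℚ 1ℚ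
      bound true  true  h = contradiction tt (h tt)
      bound true  false h = ℚP.≤-refl
      bound false true  h = ℚP.≤-refl
      bound false false h = ℚP.nonNegative⁻¹ 1ℚ

  module _ {y : Point n} (y∈ : InPartitionPolytope L f y) where
    open InPartitionPolytope y∈

    private
      α : (Fin n → Bool) → Fin n → ℚ
      α A i = bool→ℚ (A i) * y i

      α-nonneg : ∀ A i → 0ℚ ≤ℚ α A i
      α-nonneg A i = *-nonneg (bool→ℚ-nonneg (A i)) (nonneg i)

      mass-nonneg : ∀ A → 0ℚ ≤ℚ mass A y
      mass-nonneg A = sumFin-nonneg (α-nonneg A)

      module _ {A B : Fin n → Bool} (A#B : ∀ i j → T (A i) → T (B j) → f i ≢ f j) where

        -- Either the weight is positive only for two nonloops with different labels, whose pair is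
        -- a vertex, or one factor vanishes because an element lies outside its group or is a loop.
        -- Writing the vector as a sum of two unit vectors gives a formula valid in all these cases,
        -- including `i` equal to `j`.
        cone-edge : ∀ i j → InCone V (α A i * α B j)
          (λ k → (α A i * α B j) * (indicatorVec ⁅ i ⁆ k +ℚ indicatorVec ⁅ j ⁆ k))
        cone-edge i j with A i in Ai | B j in Bj | L i in Li | L j in Lj
        ... | true | true | false | false =
          cone-resp (ℚP.*-identityʳ _) (λ k → cong (1ℚ * y i * (1ℚ * y j) *_) (indicatorVec-pair (fi≢fj ∘ cong f) k))
            (cone-* (*-nonneg (*-nonneg (bool→ℚ-nonneg true) (nonneg i)) (*-nonneg (bool→ℚ-nonneg true) (nonneg j)))
              (cone-vertex (∈-map⁺ indicatorVec (complete (subst T Li) (subst T Lj) fi≢fj))))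
          where
          fi≢fj = A#B i j (subst T (sym Ai) tt) (subst T (sym Bj) tt)
        ... | false | b | _ | _ = cone-resp (lem (y i) (bool→ℚ b * y j)) (λ k → lem′ (y i) (bool→ℚ b * y j) _) cone-zero
          where
          lem : ∀ u v → 0ℚ ≡ 0ℚ * u * v
          lem = solve-∀ ℚ-ring
          lem′ : ∀ u v w → 0ℚ ≡ 0ℚ * u * v * w
          lem′ = solve-∀ ℚ-ring
        ... | a | false | _ | _ = cone-resp (lem (bool→ℚ a * y i) (y j)) (λ k → lem′ (bool→ℚ a * y i) (y j) _) cone-zero
          where
          lem : ∀ u v → 0ℚ ≡ u * (0ℚ * v)
          lem = solve-∀ ℚ-ring
          lem′ : ∀ u v w → 0ℚ ≡ u * (0ℚ * v) * w
          lem′ = solve-∀ ℚ-ring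
        ... | a | b | true | _ rewrite loop i (subst T (sym Li) tt) =
          cone-resp (lem (bool→ℚ a) (bool→ℚ b * y j)) (λ k → lem′ (bool→ℚ a) (bool→ℚ b * y j) _) cone-zero
          where
          lem : ∀ u v → 0ℚ ≡ u * 0ℚ * v
          lem = solve-∀ ℚ-ring
          lem′ : ∀ u v w → 0ℚ ≡ u * 0ℚ * v * w
          lem′ = solve-∀ ℚ-ring
        ... | a | b | _ | true rewrite loop j (subst T (sym Lj) tt) =
          cone-resp (lem (bool→ℚ a * y i) (bool→ℚ b)) (λ k → lem′ (bool→ℚ a * y i) (bool→ℚ b) _) cone-zero
          where
          lem : ∀ u v → 0ℚ ≡ u * (v * 0ℚ)
          lem = solve-∀ ℚ-ring
          lem′ : ∀ u v w → 0ℚ ≡ u * (v * 0ℚ) * w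
          lem′ = solve-∀ ℚ-ring

        -- The product coupling of the two distributions: weighting the edge from `i` to `j` by
        -- `α A i * α B j` and summing over one index leaves the other distribution times a total
        -- mass.
        cone-product : InCone V (mass A y * mass B y) (λ k → mass B y * α A k +ℚ mass A y * α B k)
        cone-product = cone-resp (sumFin-*-sumFin (α A) (α B)) combination
          (cone-∑ (λ i → cone-∑ (λ j → cone-edge i j)))
          where
          open ≡-Reasoning
          swap : ∀ a b c d → (a * b) * (c +ℚ d) ≡ (a * c) * b +ℚ a * (b * d)
          swap = solve-∀ ℚ-ring
          pick : ∀ (a : Fin n → ℚ) k → sumFin (λ i → a i * indicatorVec ⁅ i ⁆ k) ≡ a k
          pick a k = trans (sumFin-single (λ i → a i * indicatorVec ⁅ i ⁆ k) k
                             (λ i i≢k → trans (cong (λ b → a i * bool→ℚ b) (memᵇ-singleton-≢ i k i≢k)) (ℚP.*-zeroʳ (a i))))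
                           (trans (cong (λ b → a k * bool→ℚ b) (memᵇ-singleton k)) (ℚP.*-identityʳ (a k)))
          combination : ∀ k →
            sumFin (λ i → sumFin (λ j → (α A i * α B j) * (indicatorVec ⁅ i ⁆ k +ℚ indicatorVec ⁅ j ⁆ k)))
            ≡ mass B y * α A k +ℚ mass A y * α B k
          combination k = begin
            sumFin (λ i → sumFin (λ j → (α A i * α B j) * (e i +ℚ e j)))
              ≡⟨ sumFin-cong (λ i → trans (sumFin-cong (λ j → swap (α A i) (α B j) (e i) (e j)))
                                          (sumFin-+ (λ j → α A i * e i * α B j) (λ j → α A i * (α B j * e j)))) ⟩
            sumFin (λ i → sumFin (λ j → (α A i * e i) * α B j) +ℚ sumFin (λ j → α A i * (α B j * e j)))
              ≡⟨ sumFin-+ (λ i → sumFin (λ j → (α A i * e i) * α B j)) (λ i → sumFin (λ j → α A i * (α B j * e j))) ⟩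
            sumFin (λ i → sumFin (λ j → (α A i * e i) * α B j)) +ℚ sumFin (λ i → sumFin (λ j → α A i * (α B j * e j)))
              ≡⟨ cong₂ _+ℚ_ (sumFin-*-sumFin (λ i → α A i * e i) (α B)) (sumFin-*-sumFin (α A) (λ j → α B j * e j)) ⟩
            sumFin (λ i → α A i * e i) * mass B y +ℚ mass A y * sumFin (λ j → α B j * e j)
              ≡⟨ cong₂ (λ s t → s * mass B y +ℚ mass A y * t) (pick (α A) k) (pick (α B) k) ⟩
            α A k * mass B y +ℚ mass A y * α B k
              ≡⟨ cong (_+ℚ mass A y * α B k) (ℚP.*-comm (α A k) (mass B y)) ⟩
            mass B y * α A k +ℚ mass A y * α B k ∎
            where
            e : Fin n → ℚ
            e i = indicatorVec ⁅ i ⁆ k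

        -- The product coupling normalized to total weight `t`. If a group has mass 0, the bounds
        -- force `t` to be 0, so no case distinction is needed here.
        cone-scaled-product : ∀ {t} → 0ℚ ≤ℚ t → t ≤ℚ mass A y → t ≤ℚ mass B y →
          InCone V t (λ k → t * (inv (mass A y) * α A k +ℚ inv (mass B y) * α B k))
        cone-scaled-product {t} 0≤t t≤a t≤b = cone-resp tot vec
          (cone-* (*-nonneg 0≤t (*-nonneg (inv-nonneg (mass-nonneg A)) (inv-nonneg (mass-nonneg B)))) cone-product)
          where
          open ≡-Reasoning
          a  = mass A y
          b  = mass B y
          regroup : ∀ t a b a' b' → t * (a' * b') * (a * b) ≡ t * (a * a') * (b * b')
          regroup = solve-∀ ℚ-ring
          regroup′ : ∀ t a b a' b' u v → t * (a' * b') * (b * u +ℚ a * v) ≡ t * (b * b') * (a' * u) +ℚ t * (a * a') * (b' * v)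
          regroup′ = solve-∀ ℚ-ring
          tot : t * (inv a * inv b) * (a * b) ≡ t
          tot = begin
            t * (inv a * inv b) * (a * b)    ≡⟨ regroup t a b (inv a) (inv b) ⟩
            t * (a * inv a) * (b * inv b)    ≡⟨ cong (_* (b * inv b)) (inv-cancel 0≤t t≤a) ⟩
            t * (b * inv b)                  ≡⟨ inv-cancel 0≤t t≤b ⟩
            t                                ∎
          vec : ∀ k → t * (inv a * inv b) * (b * α A k +ℚ a * α B k) ≡ t * (inv a * α A k +ℚ inv b * α B k)
          vec k = begin
            t * (inv a * inv b) * (b * α A k +ℚ a * α B k)
              ≡⟨ regroup′ t a b (inv a) (inv b) (α A k) (α B k) ⟩
            t * (b * inv b) * (inv a * α A k) +ℚ t * (a * inv a) * (inv b * α B k)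
              ≡⟨ cong₂ (λ p q → p * (inv a * α A k) +ℚ q * (inv b * α B k)) (inv-cancel 0≤t t≤b) (inv-cancel 0≤t t≤a) ⟩
            t * (inv a * α A k) +ℚ t * (inv b * α B k)
              ≡⟨ ℚP.*-distribˡ-+ t _ _ ⟨
            t * (inv a * α A k +ℚ inv b * α B k) ∎

    below at above : ℕ → Fin n → Bool
    below a i = f i <ᵇ a
    at    a i = f i ≡ᵇ a
    above a i = a <ᵇ f i

    mass-tri : ∀ a → mass (below a) y +ℚ (mass (at a) y +ℚ mass (above a) y) ≡ 2ℚ
    mass-tri a = begin
      mass (below a) y +ℚ (mass (at a) y +ℚ mass (above a) y)
        ≡⟨ cong (mass (below a) y +ℚ_) (⟨⟩-+ˡ (bool→ℚ ∘ at a) (bool→ℚ ∘ above a) y) ⟨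
      mass (below a) y +ℚ ⟨ (λ i → bool→ℚ (at a i) +ℚ bool→ℚ (above a i)) , y ⟩
        ≡⟨ ⟨⟩-+ˡ (bool→ℚ ∘ below a) (λ i → bool→ℚ (at a i) +ℚ bool→ℚ (above a i)) y ⟨
      ⟨ (λ i → bool→ℚ (below a i) +ℚ (bool→ℚ (at a i) +ℚ bool→ℚ (above a i))) , y ⟩
        ≡⟨ ⟨⟩-congˡ y (λ i → trichotomous-sum (<ᵇ-≡ᵇ-tri (f i) a)) ⟩
      ⟨ (λ _ → 1ℚ) , y ⟩
        ≡⟨ ⟨1⟩≡sumFin y ⟩
      sumFin y
        ≡⟨ total ⟩
      2ℚ ∎
      where open ≡-Reasoning

    Median : ℕ → Set
    Median a = mass (below a) y ≤ℚ 1ℚ × mass (above a) y ≤ℚ 1ℚ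

    -- A walk along the labels: as long as no median has been met, the mass accumulated below the
    -- current label stays under 1.
    median-or-light : ∀ m → ∃ Median ⊎ mass (below m) y <ℚ 1ℚ
    median-or-light zero = inj₂ (subst (_<ℚ 1ℚ) (sym (sumFin-0 {n} _ (λ i → ℚP.*-zeroˡ (y i)))) (ℚP.positive⁻¹ 1ℚ))
    median-or-light (suc m) with median-or-light m
    ... | inj₁ med = inj₁ med
    ... | inj₂ light with mass (below m) y +ℚ mass (at m) y ℚP.<? 1ℚ
    ...   | yes lt = inj₂ (subst (_<ℚ 1ℚ) (sym split) lt)
      where
      split : mass (below (suc m)) y ≡ mass (below m) y +ℚ mass (at m) y
      split = trans (⟨⟩-congˡ y (λ i → <ᵇ-suc (f i) m)) (⟨⟩-+ˡ (bool→ℚ ∘ below m) (bool→ℚ ∘ at m) y)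
    -- The accumulated mass reaches 1 exactly at label `m`. What remains above it is 2 minus that
    -- mass, hence at most 1.
    ...   | no ¬lt = inj₁ (m , ℚP.<⇒≤ light , ≤-offset _ (0≤- (ℚP.≮⇒≥ ¬lt)) (complement (mass (below m) y) (mass (at m) y) (mass (above m) y) (mass-tri m)))
      where
      regroup : ∀ x q z → z +ℚ (x +ℚ q - 1ℚ) ≡ x +ℚ (q +ℚ z) - 1ℚ
      regroup = solve-∀ ℚ-ring
      complement : ∀ x q z → x +ℚ (q +ℚ z) ≡ 2ℚ → 1ℚ ≡ z +ℚ (x +ℚ q - 1ℚ)
      complement x q z eq = sym (trans (regroup x q z) (cong (_- 1ℚ) eq))

    median : ∀ N → (∀ i → f i ℕ.≤ N) → ∃ Median
    median N f≤N with median-or-light (suc N)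
    ... | inj₁ med   = med
    -- Everything lies below `suc N`, so the accumulated mass there is 2.
    ... | inj₂ light = contradiction
      (subst (_<ℚ 1ℚ) (trans (⟨⟩-congˡ y (λ i → cong bool→ℚ (T⇒≡ (ℕP.<⇒<ᵇ (ℕ.s≤s (f≤N i)))))) (trans (⟨1⟩≡sumFin y) total)) light)
      (λ 2<1 → ℚP.<-asym 2<1 (ℚP.+-monoʳ-< 1ℚ (ℚP.positive⁻¹ 1ℚ)))

    -- Grouping the classes below, at and above a median class leaves three classes of masses
    -- x, q, z ≤ 1 with x + q + z = 2; the weights of the three kinds of edges are then forced.
    partitionPolytope⇒hull : ∀ N → (∀ i → f i ℕ.≤ N) → y ∈Hull V
    partitionPolytope⇒hull N f≤N = cone⇒hull (cone-resp (total-weight x q z tri) vec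
      -- When only edges between different groups are used, those meeting Z weigh `z` altogether, so
      -- the edges between X and Q get the remaining `1ℚ - z`; likewise for the other two pairs.
      -- Each such weight is at most both masses involved, since for instance `x` is the sum of
      -- `1ℚ - z` and `1ℚ - q`.
      (cone-+ (cone-scaled-product X#Q (0≤- z≤1) (≤-offset _ (0≤- q≤1) x≡) (≤-offset _ (0≤- x≤1) q≡))
      (cone-+ (cone-scaled-product X#Z (0≤- q≤1) (≤-offset _ (0≤- z≤1) (trans x≡ (ℚP.+-comm (1ℚ - z) _))) (≤-offset _ (0≤- x≤1) z≡))
              (cone-scaled-product Q#Z (0≤- x≤1) (≤-offset _ (0≤- z≤1) (trans q≡ (ℚP.+-comm (1ℚ - z) _)))
                                                 (≤-offset _ (0≤- q≤1) (trans z≡ (ℚP.+-comm (1ℚ - q) _)))))))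
      where
      open ≡-Reasoning
      a = proj₁ (median N f≤N)
      X = α (below a)
      Q = α (at a)
      Z = α (above a)
      x = mass (below a) y
      q = mass (at a) y
      z = mass (above a) y
      x≤1 = proj₁ (proj₂ (median N f≤N))
      q≤1 = class≤ a
      z≤1 = proj₂ (proj₂ (median N f≤N))
      tri = mass-tri a

      X#Q : ∀ i j → T (below a i) → T (at a j) → f i ≢ f j
      X#Q i j p r e = ℕP.<⇒≢ (ℕP.<ᵇ⇒< _ _ p) (trans e (ℕP.≡ᵇ⇒≡ _ _ r))
      X#Z : ∀ i j → T (below a i) → T (above a j) → f i ≢ f j
      X#Z i j p r = ℕP.<⇒≢ (ℕP.<-trans (ℕP.<ᵇ⇒< _ _ p) (ℕP.<ᵇ⇒< _ _ r))
      Q#Z : ∀ i j → T (at a i) → T (above a j) → f i ≢ f j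
      Q#Z i j p r e = ℕP.<⇒≢ (ℕP.<ᵇ⇒< _ _ r) (trans (sym (ℕP.≡ᵇ⇒≡ _ _ p)) e)

      complement₁ : ∀ x q z → x +ℚ (q +ℚ z) ≡ 2ℚ → x ≡ (1ℚ - z) +ℚ (1ℚ - q)
      complement₁ x q z eq = trans (lhs x q z) (trans (cong (λ s → s - q - z) eq) (rhs q z))
        where
        lhs : ∀ x q z → x ≡ x +ℚ (q +ℚ z) - q - z
        lhs = solve-∀ ℚ-ring
        rhs : ∀ q z → 1ℚ +ℚ 1ℚ - q - z ≡ (1ℚ - z) +ℚ (1ℚ - q)
        rhs = solve-∀ ℚ-ring
      rotate : ∀ x q z → q +ℚ (x +ℚ z) ≡ x +ℚ (q +ℚ z)
      rotate = solve-∀ ℚ-ring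
      rotate′ : ∀ x q z → z +ℚ (x +ℚ q) ≡ x +ℚ (q +ℚ z)
      rotate′ = solve-∀ ℚ-ring
      x≡ : x ≡ (1ℚ - z) +ℚ (1ℚ - q)
      x≡ = complement₁ x q z tri
      q≡ : q ≡ (1ℚ - z) +ℚ (1ℚ - x)
      q≡ = complement₁ q x z (trans (rotate x q z) tri)
      z≡ : z ≡ (1ℚ - q) +ℚ (1ℚ - x)
      z≡ = complement₁ z x q (trans (rotate′ x q z) tri)

      total-weight : ∀ x q z → x +ℚ (q +ℚ z) ≡ 2ℚ → (1ℚ - z) +ℚ ((1ℚ - q) +ℚ (1ℚ - x)) ≡ 1ℚ
      total-weight x q z eq = trans (lhs x q z) (cong (1ℚ +ℚ 1ℚ +ℚ 1ℚ -_) eq)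
        where
        lhs : ∀ x q z → (1ℚ - z) +ℚ ((1ℚ - q) +ℚ (1ℚ - x)) ≡ 1ℚ +ℚ 1ℚ +ℚ 1ℚ - (x +ℚ (q +ℚ z))
        lhs = solve-∀ ℚ-ring

      regroup : ∀ x' q' z' u v w r s t →
        r * (x' * u +ℚ q' * v) +ℚ (s * (x' * u +ℚ z' * w) +ℚ t * (q' * v +ℚ z' * w))
        ≡ u * ((r +ℚ s) * x') +ℚ (v * ((r +ℚ t) * q') +ℚ w * ((s +ℚ t) * z'))
      regroup = solve-∀ ℚ-ring

      -- A group of mass 0 is covered too, because an entry is bounded by the mass of its group.
      rescale : ∀ A k → α A k * (mass A y * inv (mass A y)) ≡ α A k
      rescale A k = inv-cancel (α-nonneg A k) (term≤sumFin (α A) (α-nonneg A) k)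

      vec : ∀ k → (1ℚ - z) * (inv x * X k +ℚ inv q * Q k)
                  +ℚ ((1ℚ - q) * (inv x * X k +ℚ inv z * Z k) +ℚ (1ℚ - x) * (inv q * Q k +ℚ inv z * Z k)) ≡ y k
      vec k = begin
        (1ℚ - z) * (inv x * X k +ℚ inv q * Q k)
          +ℚ ((1ℚ - q) * (inv x * X k +ℚ inv z * Z k) +ℚ (1ℚ - x) * (inv q * Q k +ℚ inv z * Z k))
          ≡⟨ regroup (inv x) (inv q) (inv z) (X k) (Q k) (Z k) (1ℚ - z) (1ℚ - q) (1ℚ - x) ⟩
        X k * (((1ℚ - z) +ℚ (1ℚ - q)) * inv x)
          +ℚ (Q k * (((1ℚ - z) +ℚ (1ℚ - x)) * inv q) +ℚ Z k * (((1ℚ - q) +ℚ (1ℚ - x)) * inv z))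
          ≡⟨ cong₂ (λ s t → X k * (s * inv x) +ℚ t) (sym x≡)
               (cong₂ (λ s t → Q k * (s * inv q) +ℚ Z k * (t * inv z)) (sym q≡) (sym z≡)) ⟩
        X k * (x * inv x) +ℚ (Q k * (q * inv q) +ℚ Z k * (z * inv z))
          ≡⟨ cong₂ _+ℚ_ (rescale (below a) k) (cong₂ _+ℚ_ (rescale (at a) k) (rescale (above a) k)) ⟩
        X k +ℚ (Q k +ℚ Z k)
          ≡⟨ factor (bool→ℚ (below a k)) (bool→ℚ (at a k)) (bool→ℚ (above a k)) (y k) ⟩
        (bool→ℚ (below a k) +ℚ (bool→ℚ (at a k) +ℚ bool→ℚ (above a k))) * y k
          ≡⟨ cong (_* y k) (trichotomous-sum (<ᵇ-≡ᵇ-tri (f k) a)) ⟩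
        1ℚ * y k
          ≡⟨ ℚP.*-identityˡ (y k) ⟩
        y k ∎
        where
        factor : ∀ a b c y → a * y +ℚ (b * y +ℚ c * y) ≡ (a +ℚ (b +ℚ c)) * y
        factor = solve-∀ ℚ-ring

-- Subsets

T-not : ∀ {b} → ¬ T b → T (not b)
T-not {true}  ¬t = ¬t tt
T-not {false} _  = tt

T-not⁻ : ∀ {b} → T (not b) → ¬ T b
T-not⁻ {false} _ ()

memᵇ⇒∈ : ∀ {n i} {s : Subset n} → T (memᵇ i s) → i ∈ₛ s
memᵇ⇒∈ {i = i} {s} t = VecP.lookup⇒[]= i s (T⇒≡ t)

∈⇒memᵇ : ∀ {n i} {s : Subset n} → i ∈ₛ s → T (memᵇ i s)
∈⇒memᵇ i∈s = subst T (sym (VecP.[]=⇒lookup i∈s)) tt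

∈-─⁻ : ∀ {n} {x} (p q : Subset n) → x ∈ₛ p ─ q → x ∈ₛ p × x ∉ₛ q
∈-─⁻ p q x∈ = SubsetP.p─q⊆p p q x∈ , λ x∈q → go p q x∈ x∈q
  where
  go : ∀ {n x} (p q : Subset n) → x ∈ₛ p ─ q → x ∉ₛ q
  go (_ ∷ p) (true ∷ q) (Vec.there x∈) (Vec.there x∈q) = go p q x∈ x∈q
  go (_ ∷ p) (false ∷ q) (Vec.there x∈) (Vec.there x∈q) = go p q x∈ x∈q

allSubsets-complete : ∀ {n} (s : Subset n) → s ∈ allSubsets n
allSubsets-complete [] = here refl
allSubsets-complete {suc n} (b ∷ s) = ∈-concatMap⁺ _ {xs = allSubsets n} (lose (allSubsets-complete s) (member b))
  where
  member : ∀ b → b ∷ s ∈ (false ∷ s) ∷ (true ∷ s) ∷ []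
  member false = here refl
  member true  = there (here refl)

nonempty⇒1≤∣∣ : ∀ {n x} {p : Subset n} → x ∈ₛ p → 1 ℕ.≤ ∣ p ∣
nonempty⇒1≤∣∣ {x = x} {p} x∈p = subst (ℕ._≤ ∣ p ∣) (SubsetP.∣⁅x⁆∣≡1 x)
  (SubsetP.p⊆q⇒∣p∣≤∣q∣ (λ y∈ → subst (_∈ₛ p) (sym (SubsetP.x∈⁅y⁆⇒x≡y x y∈)) x∈p))

1≤∣∣⇒nonempty : ∀ {n} (p : Subset n) → 1 ℕ.≤ ∣ p ∣ → Nonempty p
1≤∣∣⇒nonempty (true  ∷ p) _ = Fin.zero , Vec.here
1≤∣∣⇒nonempty (false ∷ p) h with 1≤∣∣⇒nonempty p h
... | i , i∈p = Fin.suc i , Vec.there i∈p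

distinct⇒2≤∣∣ : ∀ {n i j} {p : Subset n} → i ≢ j → i ∈ₛ p → j ∈ₛ p → 2 ℕ.≤ ∣ p ∣
distinct⇒2≤∣∣ {i = i} {j} {p} i≢j i∈p j∈p = subst (ℕ._< ∣ p ∣) (SubsetP.∣⁅x⁆∣≡1 i)
  (SubsetP.p⊂q⇒∣p∣<∣q∣ ((λ y∈ → subst (_∈ₛ p) (sym (SubsetP.x∈⁅y⁆⇒x≡y i y∈)) i∈p)
                       , j , j∈p , λ j∈ → i≢j (sym (SubsetP.x∈⁅y⁆⇒x≡y i j∈))))

2≤∣∣⇒distinct : ∀ {n} (p : Subset n) → 2 ℕ.≤ ∣ p ∣ → ∃ λ i → ∃ λ j → i ≢ j × i ∈ₛ p × j ∈ₛ p
2≤∣∣⇒distinct (true ∷ p) (ℕ.s≤s h) with 1≤∣∣⇒nonempty p h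
... | j , j∈p = Fin.zero , Fin.suc j , (λ ()) , Vec.here , Vec.there j∈p
2≤∣∣⇒distinct (false ∷ p) h with 2≤∣∣⇒distinct p h
... | i , j , i≢j , i∈p , j∈p = Fin.suc i , Fin.suc j , (λ { refl → i≢j refl }) , Vec.there i∈p , Vec.there j∈p

⊆∧∣∣≥⇒≡ : ∀ {n} {p q : Subset n} → p ⊆ q → ∣ q ∣ ℕ.≤ ∣ p ∣ → p ≡ q
⊆∧∣∣≥⇒≡ {p = p} {q} p⊆q ∣q∣≤∣p∣ = SubsetP.⊆-antisym p⊆q q⊆p
  where
  q⊆p : q ⊆ p
  q⊆p {x} x∈q with x SubsetP.∈? p
  ... | yes x∈p = x∈p
  ... | no  x∉p = contradiction (SubsetP.p⊂q⇒∣p∣<∣q∣ (p⊆q , x , x∈q , x∉p)) (ℕP.≤⇒≯ ∣q∣≤∣p∣)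

∈-pair⁻ : ∀ {n} {i j x : Fin n} → x ∈ₛ ⁅ i ⁆ ∪ ⁅ j ⁆ → x ≡ i ⊎ x ≡ j
∈-pair⁻ {i = i} {j} x∈ = [ inj₁ ∘ SubsetP.x∈⁅y⁆⇒x≡y i , inj₂ ∘ SubsetP.x∈⁅y⁆⇒x≡y j ]′
                          (SubsetP.x∈p∪q⁻ ⁅ i ⁆ ⁅ j ⁆ x∈)

∈-pairˡ : ∀ {n} (i j : Fin n) → i ∈ₛ ⁅ i ⁆ ∪ ⁅ j ⁆
∈-pairˡ i j = SubsetP.x∈p∪q⁺ (inj₁ (SubsetP.x∈⁅x⁆ i))

∈-pairʳ : ∀ {n} (i j : Fin n) → j ∈ₛ ⁅ i ⁆ ∪ ⁅ j ⁆
∈-pairʳ i j = SubsetP.x∈p∪q⁺ (inj₂ (SubsetP.x∈⁅x⁆ j))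

∣∣≡2⇒pair : ∀ {n} (p : Subset n) → ∣ p ∣ ≡ 2 → ∃ λ i → ∃ λ j → i ≢ j × p ≡ ⁅ i ⁆ ∪ ⁅ j ⁆
∣∣≡2⇒pair p eq with 2≤∣∣⇒distinct p (ℕP.≤-reflexive (sym eq))
... | i , j , i≢j , i∈p , j∈p = i , j , i≢j , sym (⊆∧∣∣≥⇒≡ sub
        (subst (ℕ._≤ ∣ ⁅ i ⁆ ∪ ⁅ j ⁆ ∣) (sym eq) (distinct⇒2≤∣∣ i≢j (∈-pairˡ i j) (∈-pairʳ i j))))
  where
  sub : ⁅ i ⁆ ∪ ⁅ j ⁆ ⊆ p
  sub x∈ with ∈-pair⁻ x∈
  ... | inj₁ refl = i∈p
  ... | inj₂ refl = j∈p

pair-─ : ∀ {n} {i j : Fin n} → i ≢ j → (⁅ i ⁆ ∪ ⁅ j ⁆) ─ ⁅ j ⁆ ≡ ⁅ i ⁆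
pair-─ {i = i} {j} i≢j = SubsetP.⊆-antisym sub sup
  where
  sub : (⁅ i ⁆ ∪ ⁅ j ⁆) ─ ⁅ j ⁆ ⊆ ⁅ i ⁆
  sub x∈ with ∈-─⁻ (⁅ i ⁆ ∪ ⁅ j ⁆) ⁅ j ⁆ x∈
  ... | x∈pair , x∉j with ∈-pair⁻ x∈pair
  ...   | inj₁ refl = SubsetP.x∈⁅x⁆ i
  ...   | inj₂ refl = contradiction (SubsetP.x∈⁅x⁆ j) x∉j
  sup : ⁅ i ⁆ ⊆ (⁅ i ⁆ ∪ ⁅ j ⁆) ─ ⁅ j ⁆
  sup x∈ with SubsetP.x∈⁅y⁆⇒x≡y i x∈
  ... | refl = SubsetP.x∈p∧x∉q⇒x∈p─q (∈-pairˡ i j) (λ i∈j → i≢j (SubsetP.x∈⁅y⁆⇒x≡y j i∈j))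

subsetEqᵇ⇒≡ : ∀ {n} (s t : Subset n) → T (subsetEqᵇ s t) → s ≡ t
subsetEqᵇ⇒≡ {n} s t h = trans (sym (VecP.tabulate∘lookup s)) (trans (VecP.tabulate-cong pointwise) (VecP.tabulate∘lookup t))
  where
  pointwise : ∀ i → memᵇ i s ≡ memᵇ i t
  pointwise i with memᵇ i s | memᵇ i t | All.lookup (all⁺ _ (allFin n) h) (∈-allFin i)
  ... | true  | true  | _ = refl
  ... | false | false | _ = refl

all-counterexample : ∀ {A : Set} (p : A → Bool) xs → ¬ T (all p xs) → ∃ λ x → ¬ T (p x)
all-counterexample p xs ¬all with All.all? (λ x → T? (p x)) xs
... | yes ps = contradiction (all⁻ p ps) ¬all
... | no ¬ps with find (¬All⇒Any¬ (λ x → T? (p x)) xs ¬ps)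
...   | x , _ , ¬px = x , ¬px

-- The comparison inside subsetEqᵇ is a where-function without an accessible name; a hypothetical
-- counterexample lets its predicate be inferred.
subsetEqᵇ-refl : ∀ {n} (s : Subset n) → T (subsetEqᵇ s s)
subsetEqᵇ-refl {n} s with T? (subsetEqᵇ s s)
... | yes t = t
... | no ¬t with all-counterexample _ (allFin n) ¬t
...   | i , ¬e with memᵇ i s
...     | true  = contradiction tt ¬e
...     | false = contradiction tt ¬e

-- Maxima over lists

module _ {A : Set} (g : A → ℕ) where

  private
    maximum : List A → ℕ
    maximum = foldr (λ x r → g x ⊔ r) 0

  ≤-maximum : ∀ {k x xs} → x ∈ xs → k ℕ.≤ g x → k ℕ.≤ maximum xs
  ≤-maximum (here refl) k≤ = ℕP.≤-trans k≤ (ℕP.m≤m⊔n _ _)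
  ≤-maximum {xs = y ∷ xs} (there x∈) k≤ = ℕP.≤-trans (≤-maximum x∈ k≤) (ℕP.m≤n⊔m (g y) _)

  -- The threshold is a successor because the empty maximum is 0 and no element attains it.
  maximum-attained : ∀ {k} xs → suc k ℕ.≤ maximum xs → ∃ λ x → x ∈ xs × suc k ℕ.≤ g x
  maximum-attained (x ∷ xs) h with ℕP.⊔-sel (g x) (maximum xs)
  ... | inj₁ eq = x , here refl , subst (_ ℕ.≤_) eq h
  ... | inj₂ eq with maximum-attained xs (subst (_ ℕ.≤_) eq h)
  ...   | y , y∈ , le = y , there y∈ , le

-- first p = n when p holds nowhere
first : ∀ {n} → (Fin n → Bool) → ℕ
first {zero}  p = 0
first {suc n} p = if p Fin.zero then 0 else suc (first (p ∘ Fin.suc))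

first-cong : ∀ {n} {p q : Fin n → Bool} → (∀ i → p i ≡ q i) → first p ≡ first q
first-cong {zero}  p≗q = refl
first-cong {suc n} p≗q rewrite p≗q Fin.zero | first-cong (p≗q ∘ Fin.suc) = refl

first-≤ : ∀ {n} (p : Fin n → Bool) → first p ℕ.≤ n
first-≤ {zero}  p = ℕ.z≤n
first-≤ {suc n} p with p Fin.zero
... | true  = ℕ.z≤n
... | false = ℕ.s≤s (first-≤ (p ∘ Fin.suc))

first-holds : ∀ {n} (p : Fin n → Bool) i → T (p i) → ∃ λ k → toℕ k ≡ first p × T (p k)
first-holds {suc n} p i t with p Fin.zero in eq
... | true = Fin.zero , refl , subst T (sym eq) tt
first-holds {suc n} p Fin.zero    t | false = contradiction (subst T eq t) (λ ())
first-holds {suc n} p (Fin.suc i) t | false with first-holds (p ∘ Fin.suc) i t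
... | k , k≡ , pk = Fin.suc k , cong suc k≡ , pk

-- Rank-2 matroids

module Rank2 {n} (M : Matroid n) (r2 : HasRank2 M) where
  open Matroid M using (isBase; nonempty; exchange)

  L : Fin n → Bool
  L i = memᵇ i (loops M)

  L≡ : ∀ i → L i ≡ isLoopᵇ M i
  L≡ i = trans (VecP.lookup-map i (isLoopᵇ M) (Vec.allFin n)) (cong (isLoopᵇ M) (VecP.lookup-allFin i))

  Base : Fin n → Fin n → Set
  Base i j = T (isBase (⁅ i ⁆ ∪ ⁅ j ⁆))

  base-sym : ∀ {i j} → Base i j → Base j i
  base-sym {i} {j} = subst (T ∘ isBase) (SubsetP.∪-comm ⁅ i ⁆ ⁅ j ⁆)

  base-irrefl : ∀ {i j} → Base i j → i ≢ j
  base-irrefl {i} b refl = contradiction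
    (trans (sym (SubsetP.∣⁅x⁆∣≡1 i)) (trans (cong ∣_∣ (sym (SubsetP.∪-idem ⁅ i ⁆))) (r2 _ b))) (λ ())

  ∈-bases⁺ : ∀ {B} → T (isBase B) → B ∈ bases M
  ∈-bases⁺ {B} = ∈-filter⁺ (T? ∘ isBase) (allSubsets-complete B)

  ∈-bases⁻ : ∀ {B} → B ∈ bases M → T (isBase B)
  ∈-bases⁻ B∈ = proj₂ (∈-filter⁻ (T? ∘ isBase) {xs = allSubsets n} B∈)

  ∈-bases-pair : ∀ {B} → B ∈ bases M → ∃ λ i → ∃ λ j → Base i j × B ≡ ⁅ i ⁆ ∪ ⁅ j ⁆
  ∈-bases-pair {B} B∈ with ∣∣≡2⇒pair B (r2 B (∈-bases⁻ B∈))
  ... | i , j , _ , refl = i , j , ∈-bases⁻ B∈ , refl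

  -- Loops and flats of rank 1 involve the rank only through the thresholds 1 and 2. This lemma and
  -- the next three translate those thresholds into statements about `Base`.
  base⇒1≤rank : ∀ {i j S} → Base i j → i ∈ₛ S → 1 ℕ.≤ rank M S
  base⇒1≤rank {i} {j} {S} b i∈S = ≤-maximum (λ B → ∣ S ∩ B ∣) (∈-bases⁺ b)
    (nonempty⇒1≤∣∣ (SubsetP.x∈p∩q⁺ (i∈S , ∈-pairˡ i j)))

  1≤rank⇒base : ∀ S → 1 ℕ.≤ rank M S → ∃ λ i → ∃ λ j → i ∈ₛ S × Base i j
  1≤rank⇒base S h with maximum-attained (λ B → ∣ S ∩ B ∣) (bases M) h
  ... | B , B∈ , le with 1≤∣∣⇒nonempty (S ∩ B) le | ∈-bases-pair B∈
  ... | x , x∈ | i , j , b , refl with SubsetP.x∈p∩q⁻ S _ x∈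
  ...   | x∈S , x∈B with ∈-pair⁻ x∈B
  ...     | inj₁ refl = i , j , x∈S , b
  ...     | inj₂ refl = j , i , x∈S , base-sym b

  base⇒2≤rank : ∀ {i j S} → Base i j → i ∈ₛ S → j ∈ₛ S → 2 ℕ.≤ rank M S
  base⇒2≤rank {i} {j} {S} b i∈S j∈S = ≤-maximum (λ B → ∣ S ∩ B ∣) (∈-bases⁺ b)
    (distinct⇒2≤∣∣ (base-irrefl b) (SubsetP.x∈p∩q⁺ (i∈S , ∈-pairˡ i j)) (SubsetP.x∈p∩q⁺ (j∈S , ∈-pairʳ i j)))

  2≤rank⇒base : ∀ S → 2 ℕ.≤ rank M S → ∃ λ i → ∃ λ j → i ∈ₛ S × j ∈ₛ S × Base i j
  2≤rank⇒base S h with maximum-attained (λ B → ∣ S ∩ B ∣) (bases M) h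
  ... | B , B∈ , le with 2≤∣∣⇒distinct (S ∩ B) le | ∈-bases-pair B∈
  ... | x , y , x≢y , x∈ , y∈ | i , j , b , refl
    with SubsetP.x∈p∩q⁻ S _ x∈ | SubsetP.x∈p∩q⁻ S _ y∈
  ...   | x∈S , x∈B | y∈S , y∈B with ∈-pair⁻ x∈B | ∈-pair⁻ y∈B
  ...     | inj₁ refl | inj₁ refl = contradiction refl x≢y
  ...     | inj₁ refl | inj₂ refl = i , j , x∈S , y∈S , b
  ...     | inj₂ refl | inj₁ refl = i , j , y∈S , x∈S , b
  ...     | inj₂ refl | inj₂ refl = contradiction refl x≢y

  base⇒nonloop : ∀ {i j} → Base i j → ¬ T (L i)
  base⇒nonloop {i} b Li with ℕP.≡ᵇ⇒≡ (rank M ⁅ i ⁆) 0 (subst T (L≡ i) Li)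
  ... | r≡0 = contradiction (subst (1 ℕ.≤_) r≡0 (base⇒1≤rank b (SubsetP.x∈⁅x⁆ i))) (λ ())

  nonloop⇒base : ∀ {i} → ¬ T (L i) → ∃ λ j → Base i j
  nonloop⇒base {i} ¬Li = conclude
    (1≤rank⇒base ⁅ i ⁆ (ℕP.n≢0⇒n>0 (λ r≡0 → ¬Li (subst T (sym (L≡ i)) (ℕP.≡⇒≡ᵇ (rank M ⁅ i ⁆) 0 r≡0)))))
    where
    conclude : (∃ λ k → ∃ λ j → k ∈ₛ ⁅ i ⁆ × Base k j) → ∃ λ j → Base i j
    conclude (k , j , k∈ , b) = j , subst (λ x → Base x j) (SubsetP.x∈⁅y⁆⇒x≡y i k∈) b

  base-exchange : ∀ {i k j m} → Base j m → Base i k → m ≢ i → m ≢ k → Base j i ⊎ Base j k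
  base-exchange {i} {k} {j} {m} jm ik m≢i m≢k = conclude
    (exchange (⁅ j ⁆ ∪ ⁅ m ⁆) (⁅ i ⁆ ∪ ⁅ k ⁆) jm ik m (∈⇒memᵇ (∈-pairʳ j m))
              (T-not (λ t → [ m≢i , m≢k ]′ (∈-pair⁻ (memᵇ⇒∈ t)))))
    where
    partner : ∀ y → y ∈ₛ ⁅ i ⁆ ∪ ⁅ k ⁆ → Base j y → Base j i ⊎ Base j k
    partner y y∈ b with ∈-pair⁻ y∈
    ... | inj₁ refl = inj₁ b
    ... | inj₂ refl = inj₂ b
    conclude : Σ (Fin n) (λ y → T (memᵇ y (⁅ i ⁆ ∪ ⁅ k ⁆)) × T (not (memᵇ y (⁅ j ⁆ ∪ ⁅ m ⁆))) ×
                                T (isBase (((⁅ j ⁆ ∪ ⁅ m ⁆) ─ ⁅ m ⁆) ∪ ⁅ y ⁆))) → Base j i ⊎ Base j k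
    conclude (y , y∈ , _ , b) =
      partner y (memᵇ⇒∈ y∈) (subst (λ S → T (isBase (S ∪ ⁅ y ⁆))) (pair-─ (base-irrefl jm)) b)

  -- This is transitivity of parallelism in contrapositive form. The nonloop `j` lies in some base
  -- with a partner `m`; if `m` is neither `i` nor `k`, exchanging `m` against the base of `i` and
  -- `k` gives `j` one of them as partner.
  base-split : ∀ {i k} j → ¬ T (L j) → Base i k → Base i j ⊎ Base j k
  base-split {i} {k} j ¬Lj ik = conclude (nonloop⇒base ¬Lj)
    where
    conclude : (∃ λ m → Base j m) → Base i j ⊎ Base j k
    conclude (m , jm) with m Fin.≟ i | m Fin.≟ k
    ... | yes refl | _        = inj₁ (base-sym jm)
    ... | no  _    | yes refl = inj₂ jm
    ... | no  m≢i  | no m≢k   = map₁ base-sym (base-exchange jm ik m≢i m≢k)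

  -- Parallel elements and their classes

  parallel : Fin n → Fin n → Bool
  parallel i k = not (L i) ∧ not (L k) ∧ not (isBase (⁅ i ⁆ ∪ ⁅ k ⁆))

  parallel⁺ : ∀ {i k} → ¬ T (L i) → ¬ T (L k) → ¬ Base i k → T (parallel i k)
  parallel⁺ ¬Li ¬Lk ¬b = Equivalence.from T-∧ (T-not ¬Li , Equivalence.from T-∧ (T-not ¬Lk , T-not ¬b))

  parallel⁻ : ∀ i k → T (parallel i k) → ¬ T (L i) × ¬ T (L k) × ¬ Base i k
  parallel⁻ i k t = let (p , t′) = Equivalence.to T-∧ t ; (q , r) = Equivalence.to (T-∧ {not (L k)}) t′
                    in T-not⁻ p , T-not⁻ q , T-not⁻ r

  parallel-refl : ∀ {i} → ¬ T (L i) → T (parallel i i)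
  parallel-refl ¬Li = parallel⁺ ¬Li ¬Li (λ b → base-irrefl b refl)

  parallel-sym : ∀ {i k} → T (parallel i k) → T (parallel k i)
  parallel-sym {i} {k} t with parallel⁻ i k t
  ... | ¬Li , ¬Lk , ¬b = parallel⁺ ¬Lk ¬Li (¬b ∘ base-sym)

  parallel-trans : ∀ {i j k} → T (parallel i j) → T (parallel j k) → T (parallel i k)
  parallel-trans {i} {j} {k} s t with parallel⁻ i j s | parallel⁻ j k t
  ... | ¬Li , ¬Lj , ¬ij | _ , ¬Lk , ¬jk = parallel⁺ ¬Li ¬Lk (λ b → [ ¬ij , ¬jk ]′ (base-split j ¬Lj b))

  T-ext : ∀ {a b} → (T a → T b) → (T b → T a) → a ≡ b
  T-ext {true}  {true}  _ _ = refl
  T-ext {true}  {false} f _ = contradiction (f tt) (λ ())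
  T-ext {false} {true}  _ g = contradiction (g tt) (λ ())
  T-ext {false} {false} _ _ = refl

  parallel-cong : ∀ {i j} → T (parallel i j) → ∀ k → parallel i k ≡ parallel j k
  parallel-cong ij k = T-ext (parallel-trans (parallel-sym ij)) (parallel-trans ij)

  -- The least element of the class serves as canonical name. A loop is parallel to nothing and so
  -- receives the label `n`, which no nonloop has.
  label : Fin n → ℕ
  label i = first (parallel i)

  label-≡⁺ : ∀ {i j} → T (parallel i j) → label i ≡ label j
  label-≡⁺ ij = first-cong (parallel-cong ij)

  label-≡⁻ : ∀ {i j} → ¬ T (L i) → ¬ T (L j) → label i ≡ label j → T (parallel i j)
  label-≡⁻ {i} {j} ¬Li ¬Lj eq
    with first-holds (parallel i) i (parallel-refl ¬Li) | first-holds (parallel j) j (parallel-refl ¬Lj)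
  ... | k , k≡ , ik | m , m≡ , jm with FinP.toℕ-injective (trans k≡ (trans eq (sym m≡)))
  ...   | refl = parallel-trans ik (parallel-sym jm)

  bases-across : PairsAcross L label (bases M)
  bases-across = record { complete = complete ; sound = sound }
    where
    complete : ∀ {i j} → ¬ T (L i) → ¬ T (L j) → label i ≢ label j → ⁅ i ⁆ ∪ ⁅ j ⁆ ∈ bases M
    complete {i} {j} ¬Li ¬Lj ne with T? (isBase (⁅ i ⁆ ∪ ⁅ j ⁆))
    ... | yes b = ∈-bases⁺ b
    ... | no ¬b = contradiction (label-≡⁺ (parallel⁺ ¬Li ¬Lj ¬b)) ne
    sound : ∀ {B} → B ∈ bases M → ∃ λ i → ∃ λ j → ¬ T (L i) × ¬ T (L j) × label i ≢ label j × B ≡ ⁅ i ⁆ ∪ ⁅ j ⁆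
    sound B∈ with ∈-bases-pair B∈
    ... | i , j , b , eq = i , j , base⇒nonloop b , base⇒nonloop (base-sym b) , ne , eq
      where
      ne : label i ≢ label j
      ne e = proj₂ (proj₂ (parallel⁻ i j (label-≡⁻ (base⇒nonloop b) (base⇒nonloop (base-sym b)) e))) b

  class : Fin n → Subset n
  class i = Vec.tabulate (parallel i)

  memᵇ-class : ∀ i k → memᵇ k (class i) ≡ parallel i k
  memᵇ-class i k = VecP.lookup∘tabulate (parallel i) k

  class-cong : ∀ {i j} → T (parallel i j) → class i ≡ class j
  class-cong ij = VecP.tabulate-cong (parallel-cong ij)

  ∈-class⁺ : ∀ {i k} → T (parallel i k) → k ∈ₛ class i
  ∈-class⁺ {i} {k} t = memᵇ⇒∈ (subst T (sym (memᵇ-class i k)) t)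

  ∈-class⁻ : ∀ {i k} → k ∈ₛ class i → T (parallel i k)
  ∈-class⁻ {i} {k} k∈ = subst T (memᵇ-class i k) (∈⇒memᵇ k∈)

  -- Flats of rank 1 and parallel classes

  FlatOfRank1 : Subset n → Set
  FlatOfRank1 F = rank M F ≡ 1 × (∀ k → k ∈ₛ F ⊎ rank M F ℕ.< rank M (F ∪ ⁅ k ⁆))

  flat⇒class : ∀ F → FlatOfRank1 F → ∃ λ i → ¬ T (L i) × F ─ loops M ≡ class i
  flat⇒class F (r≡1 , closed) with 1≤rank⇒base F (ℕP.≤-reflexive (sym r≡1))
  ... | i , j , i∈F , b = i , ¬Li , SubsetP.⊆-antisym sub sup
    where
    ¬Li = base⇒nonloop b
    noBase : ∀ {x y} → x ∈ₛ F → y ∈ₛ F → ¬ Base x y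
    noBase x∈ y∈ b = contradiction (subst (2 ℕ.≤_) r≡1 (base⇒2≤rank b x∈ y∈)) (λ { (ℕ.s≤s ()) })
    sub : F ─ loops M ⊆ class i
    sub {k} k∈ with ∈-─⁻ F (loops M) k∈
    ... | k∈F , k∉L = ∈-class⁺ (parallel⁺ ¬Li (k∉L ∘ memᵇ⇒∈) (noBase i∈F k∈F))
    -- The nonloop `i` would form a base with `x`, which lies in `F` together with `i`, or with `k`,
    -- which is parallel to `i`.
    mixed : ∀ {x k} → T (parallel i k) → x ∈ₛ F → ¬ Base x k
    mixed {x} {k} ik x∈ b = [ noBase x∈ i∈F , proj₂ (proj₂ (parallel⁻ i k ik)) ]′ (base-split i ¬Li b)
    sup : class i ⊆ F ─ loops M
    sup {k} k∈ with ∈-class⁻ {i} k∈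
    ... | ik with parallel⁻ i k ik
    ...   | _ , ¬Lk , _ = SubsetP.x∈p∧x∉q⇒x∈p─q k∈F (λ k∈L → ¬Lk (∈⇒memᵇ k∈L))
      where
      k∈F : k ∈ₛ F
      k∈F with closed k
      ... | inj₁ k∈F = k∈F
      -- If adding `k` raised the rank, a base would lie in the enlarged set. Its elements are not
      -- both in `F` and not both equal to `k`, and `mixed` excludes one of each.
      ... | inj₂ lt with 2≤rank⇒base (F ∪ ⁅ k ⁆) (subst (ℕ._< rank M (F ∪ ⁅ k ⁆)) r≡1 lt)
      ...   | x , y , x∈ , y∈ , b with SubsetP.x∈p∪q⁻ F ⁅ k ⁆ x∈ | SubsetP.x∈p∪q⁻ F ⁅ k ⁆ y∈
      ...     | inj₁ x∈F | inj₁ y∈F = contradiction b (noBase x∈F y∈F)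
      ...     | inj₁ x∈F | inj₂ y∈k with SubsetP.x∈⁅y⁆⇒x≡y k y∈k
      ...       | refl = contradiction b (mixed ik x∈F)
      k∈F | inj₂ lt | x , y , x∈ , y∈ , b | inj₂ x∈k | inj₁ y∈F with SubsetP.x∈⁅y⁆⇒x≡y k x∈k
      ...       | refl = contradiction (base-sym b) (mixed ik y∈F)
      k∈F | inj₂ lt | x , y , x∈ , y∈ , b | inj₂ x∈k | inj₂ y∈k =
        contradiction (trans (SubsetP.x∈⁅y⁆⇒x≡y k x∈k) (sym (SubsetP.x∈⁅y⁆⇒x≡y k y∈k))) (base-irrefl b)

  -- Nonloops of the flat are all parallel to `i`, hence to each other, so the rank is 1. An element
  -- outside is a nonloop not parallel to `i`, so it forms a base with `i` and raises the rank.
  class⇒flat : ∀ i → ¬ T (L i) → FlatOfRank1 (class i ∪ loops M) × (class i ∪ loops M) ─ loops M ≡ class i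
  class⇒flat i ¬Li = (r≡1 , closed) , SubsetP.⊆-antisym sub sup
    where
    F = class i ∪ loops M
    i∈F : i ∈ₛ F
    i∈F = SubsetP.x∈p∪q⁺ (inj₁ (∈-class⁺ (parallel-refl ¬Li)))
    nonloop∈F : ∀ {k} → ¬ T (L k) → k ∈ₛ F → T (parallel i k)
    nonloop∈F {k} ¬Lk k∈ with SubsetP.x∈p∪q⁻ (class i) (loops M) k∈
    ... | inj₁ k∈c = ∈-class⁻ {i} k∈c
    ... | inj₂ k∈L = contradiction (∈⇒memᵇ k∈L) ¬Lk
    ¬2≤r : ¬ 2 ℕ.≤ rank M F
    ¬2≤r h with 2≤rank⇒base F h
    ... | x , y , x∈ , y∈ , b = proj₂ (proj₂ (parallel⁻ x y
          (parallel-trans (parallel-sym (nonloop∈F (base⇒nonloop b) x∈)) (nonloop∈F (base⇒nonloop (base-sym b)) y∈)))) b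
    r≡1 : rank M F ≡ 1
    r≡1 = ℕP.≤-antisym (ℕP.≤-pred (ℕP.≰⇒> ¬2≤r)) (base⇒1≤rank (proj₂ (nonloop⇒base ¬Li)) i∈F)
    closed : ∀ k → k ∈ₛ F ⊎ rank M F ℕ.< rank M (F ∪ ⁅ k ⁆)
    closed k with k SubsetP.∈? F
    ... | yes k∈F = inj₁ k∈F
    ... | no  k∉F with T? (isBase (⁅ i ⁆ ∪ ⁅ k ⁆))
    ...   | yes b = inj₂ (subst (ℕ._< rank M (F ∪ ⁅ k ⁆)) (sym r≡1)
              (base⇒2≤rank b (SubsetP.x∈p∪q⁺ (inj₁ i∈F)) (SubsetP.x∈p∪q⁺ (inj₂ (SubsetP.x∈⁅x⁆ k)))))
    ...   | no ¬b = contradiction (SubsetP.x∈p∪q⁺ (inj₁ (∈-class⁺ (parallel⁺ ¬Li (λ Lk → k∉F (SubsetP.x∈p∪q⁺ (inj₂ (memᵇ⇒∈ Lk)))) ¬b)))) k∉F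
    sub : F ─ loops M ⊆ class i
    sub {k} k∈ with ∈-─⁻ F (loops M) k∈
    ... | k∈F , k∉L = ∈-class⁺ (nonloop∈F (k∉L ∘ memᵇ⇒∈) k∈F)
    sup : class i ⊆ F ─ loops M
    sup {k} k∈ = SubsetP.x∈p∧x∉q⇒x∈p─q (SubsetP.x∈p∪q⁺ (inj₁ k∈))
      (λ k∈L → proj₁ (proj₂ (parallel⁻ i k (∈-class⁻ {i} k∈))) (∈⇒memᵇ k∈L))

  isFlatᵇ⇒closed : ∀ F → T (isFlatᵇ M F) → ∀ k → k ∈ₛ F ⊎ rank M F ℕ.< rank M (F ∪ ⁅ k ⁆)
  isFlatᵇ⇒closed F flat k = [ inj₁ ∘ memᵇ⇒∈ , inj₂ ∘ ℕP.<ᵇ⇒< (rank M F) (rank M (F ∪ ⁅ k ⁆)) ]′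
    (Equivalence.to (T-∨ {memᵇ k F} {rank M F <ᵇ rank M (F ∪ ⁅ k ⁆)})
      (All.lookup (all⁺ (λ i → memᵇ i F ∨ (rank M F <ᵇ rank M (F ∪ ⁅ i ⁆))) (allFin n) flat) (∈-allFin k)))

  closed⇒isFlatᵇ : ∀ F → (∀ k → k ∈ₛ F ⊎ rank M F ℕ.< rank M (F ∪ ⁅ k ⁆)) → T (isFlatᵇ M F)
  closed⇒isFlatᵇ F closed = all⁻ (λ i → memᵇ i F ∨ (rank M F <ᵇ rank M (F ∪ ⁅ i ⁆)))
    (All.universal (λ k → Equivalence.from (T-∨ {memᵇ k F} {rank M F <ᵇ rank M (F ∪ ⁅ k ⁆)})
                            ([ inj₁ ∘ ∈⇒memᵇ , inj₂ ∘ ℕP.<⇒<ᵇ ]′ (closed k))) (allFin n))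

  -- A name for the predicate under `any` in `isParallelClassᵇ`, with the same body so that the two
  -- agree by computation.
  isClassOfᵇ : Subset n → Subset n → Bool
  isClassOfᵇ P F = isFlatᵇ M F ∧ (rank M F ≡ᵇ 1) ∧ subsetEqᵇ (F ─ loops M) P

  isClassOfᵇ⁻ : ∀ P F → T (isClassOfᵇ P F) → FlatOfRank1 F × F ─ loops M ≡ P
  isClassOfᵇ⁻ P F t =
    (ℕP.≡ᵇ⇒≡ (rank M F) 1 (proj₁ t₂) , isFlatᵇ⇒closed F (proj₁ t₁)) , subsetEqᵇ⇒≡ (F ─ loops M) P (proj₂ t₂)
    where
    t₁ = Equivalence.to (T-∧ {isFlatᵇ M F} {(rank M F ≡ᵇ 1) ∧ subsetEqᵇ (F ─ loops M) P}) t
    t₂ = Equivalence.to (T-∧ {rank M F ≡ᵇ 1} {subsetEqᵇ (F ─ loops M) P}) (proj₂ t₁)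

  isClassOfᵇ⁺ : ∀ P F → FlatOfRank1 F → F ─ loops M ≡ P → T (isClassOfᵇ P F)
  isClassOfᵇ⁺ P F (r≡1 , closed) refl =
    Equivalence.from (T-∧ {isFlatᵇ M F} {(rank M F ≡ᵇ 1) ∧ subsetEqᵇ (F ─ loops M) P})
      (closed⇒isFlatᵇ F closed ,
       Equivalence.from (T-∧ {rank M F ≡ᵇ 1} {subsetEqᵇ (F ─ loops M) P})
         (ℕP.≡⇒≡ᵇ (rank M F) 1 r≡1 , subsetEqᵇ-refl (F ─ loops M)))

  ∈-parallelClasses⁻ : ∀ {P} → P ∈ parallelClasses M → ∃ λ i → ¬ T (L i) × P ≡ class i
  ∈-parallelClasses⁻ {P} P∈ = conclude
    (find (any⁻ (isClassOfᵇ P) (allSubsets n) (proj₂ (∈-filter⁻ (T? ∘ isParallelClassᵇ M) {xs = allSubsets n} P∈))))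
    where
    conclude : (∃ λ F → F ∈ allSubsets n × T (isClassOfᵇ P F)) → ∃ λ i → ¬ T (L i) × P ≡ class i
    conclude (F , _ , t) =
      let (flat , eq)      = isClassOfᵇ⁻ P F t
          (i , ¬Li , eq′) = flat⇒class F flat
      in i , ¬Li , trans (sym eq) eq′

  ∈-parallelClasses⁺ : ∀ {i} → ¬ T (L i) → class i ∈ parallelClasses M
  ∈-parallelClasses⁺ {i} ¬Li =
    ∈-filter⁺ (T? ∘ isParallelClassᵇ M) (allSubsets-complete (class i))
      (any⁺ (isClassOfᵇ (class i)) (lose (allSubsets-complete (class i ∪ loops M))
        (isClassOfᵇ⁺ (class i) (class i ∪ loops M) (proj₁ flat) (proj₂ flat))))
    where
    flat = class⇒flat i ¬Li

  -- The two elements of a base are not parallel, so no class is the whole ground set. This is why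
  -- the sum in the theorem may stop at n - 1.
  ∣class∣<n : ∀ i → ∣ class i ∣ ℕ.< n
  ∣class∣<n i with ∈-bases-pair (∈-bases⁺ (proj₂ nonempty))
  ... | a , b , ab , _ = ℕP.≤∧≢⇒< (SubsetP.∣p∣≤n (class i)) full
    where
    full : ∣ class i ∣ ≢ n
    full eq = proj₂ (proj₂ (parallel⁻ a b (parallel-trans (parallel-sym (member a)) (member b)))) ab
      where
      member : ∀ k → T (parallel i k)
      member k = ∈-class⁻ {i} (subst (k ∈ₛ_) (sym (SubsetP.∣p∣≡n⇒p≡⊤ eq)) SubsetP.∈⊤)

-- Cut hypersimplices

-- The inclusion may fail where `y` vanishes, which lets loops be ignored in all later comparisons.
mass-mono : ∀ {n} {A B : Fin n → Bool} {y : Point n} → (∀ i → 0ℚ ≤ℚ y i) →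
  (∀ i → T (A i) → T (B i) ⊎ y i ≡ 0ℚ) → mass A y ≤ℚ mass B y
mass-mono {A = A} {B} {y} y≥0 A⊆B = sumFin-mono (λ i → compare (A i) (B i) (y i) (y≥0 i) (A⊆B i))
  where
  compare : ∀ a b t → 0ℚ ≤ℚ t → (T a → T b ⊎ t ≡ 0ℚ) → bool→ℚ a * t ≤ℚ bool→ℚ b * t
  compare false b t t≥0 _ = subst (_≤ℚ bool→ℚ b * t) (sym (ℚP.*-zeroˡ t)) (*-nonneg (bool→ℚ-nonneg b) t≥0)
  compare true  b t t≥0 h with h tt
  compare true  true t t≥0 h | inj₁ _ = ℚP.≤-refl
  ... | inj₂ refl = ℚP.≤-reflexive (trans (ℚP.*-zeroʳ 1ℚ) (sym (ℚP.*-zeroʳ (bool→ℚ b))))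

entry≤mass : ∀ {n} {A : Fin n → Bool} {y : Point n} → (∀ i → 0ℚ ≤ℚ y i) → ∀ {i} → T (A i) → y i ≤ℚ mass A y
entry≤mass {A = A} {y} y≥0 {i} Ai = subst (_≤ℚ mass A y)
  (trans (cong (λ b → bool→ℚ b * y i) (T⇒≡ Ai)) (ℚP.*-identityˡ (y i)))
  (term≤sumFin (λ k → bool→ℚ (A k) * y k) (λ k → *-nonneg (bool→ℚ-nonneg (A k)) (y≥0 k)) i)

mass-empty : ∀ {n} {A : Fin n → Bool} (y : Point n) → (∀ i → ¬ T (A i)) → mass A y ≡ 0ℚ
mass-empty y ∅ = sumFin-0 _ (λ i → trans (cong (λ b → bool→ℚ b * y i) (¬T⇒≡ (∅ i))) (ℚP.*-zeroˡ (y i)))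

-- For this reason classes of size 1 give no condition beyond the bound on single entries.
mass≤1-subsingleton : ∀ {n} {A : Fin n → Bool} {y : Point n} → (∀ i → y i ≤ℚ 1ℚ) →
  (∀ i j → T (A i) → T (A j) → i ≡ j) → mass A y ≤ℚ 1ℚ
mass≤1-subsingleton {A = A} {y} y≤1 unique with FinP.any? (λ i → T? (A i))
... | no  ∄A       = subst (_≤ℚ 1ℚ) (sym (mass-empty y (λ i Ai → ∄A (i , Ai)))) (ℚP.nonNegative⁻¹ 1ℚ)
... | yes (k , Ak) = subst (_≤ℚ 1ℚ) (sym mass≡) (y≤1 k)
  where
  mass≡ : mass A y ≡ y k
  mass≡ = trans
    (sumFin-single (λ i → bool→ℚ (A i) * y i) k
      (λ i i≢k → trans (cong (λ b → bool→ℚ b * y i) (¬T⇒≡ (λ Ai → i≢k (unique i k Ai Ak)))) (ℚP.*-zeroˡ (y i))))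
    (trans (cong (λ b → bool→ℚ b * y k) (T⇒≡ Ak)) (ℚP.*-identityˡ (y k)))

-- A colouring encodes a hypersimplex on the nonloops together with one cut: the elements coloured
-- `classᶜ` are those whose mass is bounded by 1.
data Colour : Set where
  loopᶜ classᶜ freeᶜ : Colour

isLoopᶜ isClassᶜ : Colour → Bool
isLoopᶜ loopᶜ = true
isLoopᶜ _     = false
isClassᶜ classᶜ = true
isClassᶜ _      = false

record InHypersimplex {n} (L : Fin n → Bool) (y : Point n) : Set where
  field
    nonneg : ∀ i → 0ℚ ≤ℚ y i
    loop   : ∀ i → T (L i) → y i ≡ 0ℚ
    total  : sumFin y ≡ 2ℚ
    entry≤ : ∀ i → y i ≤ℚ 1ℚ

InCut : ∀ {n} → (Fin n → Colour) → Point n → Set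
InCut u y = InHypersimplex (isLoopᶜ ∘ u) y × mass (isClassᶜ ∘ u) y ≤ℚ 1ℚ

partition⇒hypersimplex : ∀ {n} {L : Fin n → Bool} {f y} → InPartitionPolytope L f y → InHypersimplex L y
partition⇒hypersimplex {f = f} {y} y∈ = record
  { nonneg = nonneg ; loop = loop ; total = total
  ; entry≤ = λ i → ℚP.≤-trans (entry≤mass {A = λ j → f j ≡ᵇ f i} nonneg (ℕP.≡⇒≡ᵇ (f i) (f i) refl)) (class≤ (f i))
  }
  where open InPartitionPolytope y∈

-- A cut hypersimplex is a partition polytope with one distinguished fibre, labelled 0, and all
-- other elements alone in their fibres; the successor keeps their labels away from 0.
cutLabel : ∀ {n} → (Fin n → Colour) → Fin n → ℕ
cutLabel u i = if isClassᶜ (u i) then 0 else suc (toℕ i)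

cutLabel-class : ∀ {n} (u : Fin n → Colour) i → T (cutLabel u i ≡ᵇ 0) → T (isClassᶜ (u i))
cutLabel-class u i t with isClassᶜ (u i)
... | true = tt

class-cutLabel : ∀ {n} (u : Fin n → Colour) i → T (isClassᶜ (u i)) → T (cutLabel u i ≡ᵇ 0)
class-cutLabel u i t with isClassᶜ (u i)
... | true = tt

cutLabel-suc : ∀ {n} (u : Fin n → Colour) a i → T (cutLabel u i ≡ᵇ suc a) → toℕ i ≡ a
cutLabel-suc u a i t with isClassᶜ (u i)
... | false = ℕP.≡ᵇ⇒≡ (toℕ i) a t

cutLabel-≤ : ∀ {n} (u : Fin n → Colour) i → cutLabel u i ℕ.≤ n
cutLabel-≤ u i with isClassᶜ (u i)
... | true  = ℕ.z≤n
... | false = FinP.toℕ<n i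

partition⇒cut : ∀ {n} (u : Fin n → Colour) {y} → InPartitionPolytope (isLoopᶜ ∘ u) (cutLabel u) y → InCut u y
partition⇒cut u y∈ = partition⇒hypersimplex y∈ ,
  ℚP.≤-trans (mass-mono nonneg (λ i c → inj₁ (class-cutLabel u i c))) (class≤ 0)
  where open InPartitionPolytope y∈

cut⇒partition : ∀ {n} (u : Fin n → Colour) {y} → InCut u y → InPartitionPolytope (isLoopᶜ ∘ u) (cutLabel u) y
cut⇒partition u {y} (y∈ , cut) = record { nonneg = nonneg ; loop = loop ; total = total ; class≤ = class≤ }
  where
  open InHypersimplex y∈
  class≤ : ∀ a → mass (λ i → cutLabel u i ≡ᵇ a) y ≤ℚ 1ℚ
  class≤ zero    = ℚP.≤-trans (mass-mono nonneg (λ i c → inj₁ (cutLabel-class u i c))) cut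
  class≤ (suc a) = mass≤1-subsingleton entry≤
    (λ i j s t → FinP.toℕ-injective (trans (cutLabel-suc u a i s) (sym (cutLabel-suc u a j t))))

-- Schubert matroids

-- The colours of the Schubert matroid with thresholds l + 1 and l + k + 1, at the zero-based
-- position `x`: first `l` loops, then a class of `k` elements, then free elements. Peeling off one
-- position at a time makes the insertion lemmas for sorting reduce by computation; `StdView`
-- recovers the inequalities.
stdColour : ℕ → ℕ → ℕ → Colour
stdColour zero    zero    x       = freeᶜ
stdColour zero    (suc k) zero    = classᶜ
stdColour zero    (suc k) (suc x) = stdColour zero k x
stdColour (suc l) k       zero    = loopᶜ
stdColour (suc l) k       (suc x) = stdColour l k x

data StdView (l k x : ℕ) : Colour → Set where
  loopᵛ  : x ℕ.< l → StdView l k x loopᶜ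
  classᵛ : l ℕ.≤ x → x ℕ.< l + k → StdView l k x classᶜ
  freeᵛ  : l + k ℕ.≤ x → StdView l k x freeᶜ

stdView : ∀ l k x → StdView l k x (stdColour l k x)
stdView zero    zero    x       = freeᵛ ℕ.z≤n
stdView zero    (suc k) zero    = classᵛ ℕ.z≤n (ℕ.s≤s ℕ.z≤n)
stdView zero    (suc k) (suc x) with stdColour zero k x | stdView zero k x
... | _ | classᵛ _ lt = classᵛ ℕ.z≤n (ℕ.s≤s lt)
... | _ | freeᵛ le    = freeᵛ (ℕ.s≤s le)
stdView (suc l) k       zero    = loopᵛ (ℕ.s≤s ℕ.z≤n)
stdView (suc l) k       (suc x) with stdColour l k x | stdView l k x
... | _ | loopᵛ lt     = loopᵛ (ℕ.s≤s lt)
... | _ | classᵛ le lt = classᵛ (ℕ.s≤s le) (ℕ.s≤s lt)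
... | _ | freeᵛ le     = freeᵛ (ℕ.s≤s le)

module _ (n x₁ x₂ : ℕ) where
  private
    test : Fin n → Fin n → Bool
    test i j = (toℕ i <ᵇ toℕ j) ∧ (x₁ ≤ᵇ suc (toℕ i)) ∧ (x₂ ≤ᵇ suc (toℕ j))

    basesFrom : Fin n → List (Subset n)
    basesFrom i = map (λ j → ⁅ i ⁆ ∪ ⁅ j ⁆) (filterᵇ (test i) (allFin n))

  ∈-schubertBases⁺ : ∀ {i j} → toℕ i ℕ.< toℕ j → x₁ ℕ.≤ suc (toℕ i) → x₂ ℕ.≤ suc (toℕ j) →
    ⁅ i ⁆ ∪ ⁅ j ⁆ ∈ schubertBases n x₁ x₂
  ∈-schubertBases⁺ {i} {j} i<j x₁≤i x₂≤j = ∈-concatMap⁺ basesFrom (lose (∈-allFin i)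
    (∈-map⁺ (λ j → ⁅ i ⁆ ∪ ⁅ j ⁆) (∈-filter⁺ (T? ∘ test i) (∈-allFin j)
      (Equivalence.from (T-∧ {toℕ i <ᵇ toℕ j}) (ℕP.<⇒<ᵇ i<j ,
        Equivalence.from (T-∧ {x₁ ≤ᵇ suc (toℕ i)}) (ℕP.≤⇒≤ᵇ x₁≤i , ℕP.≤⇒≤ᵇ x₂≤j))))))

  ∈-schubertBases⁻ : ∀ {B} → B ∈ schubertBases n x₁ x₂ →
    ∃ λ i → ∃ λ j → toℕ i ℕ.< toℕ j × x₁ ℕ.≤ suc (toℕ i) × x₂ ℕ.≤ suc (toℕ j) × B ≡ ⁅ i ⁆ ∪ ⁅ j ⁆
  ∈-schubertBases⁻ B∈ =
    let (i , _ , B∈ᵢ)  = find (∈-concatMap⁻ basesFrom {xs = allFin n} B∈)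
        (j , j∈ , eq)  = ∈-map⁻ (λ j → ⁅ i ⁆ ∪ ⁅ j ⁆) B∈ᵢ
        t              = proj₂ (∈-filter⁻ (T? ∘ test i) {xs = allFin n} j∈)
        (t₁ , t′)      = Equivalence.to (T-∧ {toℕ i <ᵇ toℕ j}) t
        (t₂ , t₃)      = Equivalence.to (T-∧ {x₁ ≤ᵇ suc (toℕ i)}) t′
    in i , j , ℕP.<ᵇ⇒< _ _ t₁ , ℕP.≤ᵇ⇒≤ _ _ t₂ , ℕP.≤ᵇ⇒≤ _ _ t₃ , eq

module _ (n l k : ℕ) where
  private
    u : Fin n → Colour
    u i = stdColour l k (toℕ i)

    𝓑 = schubertBases n (l + 1) (l + k + 1)

  schubert-across : PairsAcross (isLoopᶜ ∘ u) (cutLabel u) 𝓑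
  schubert-across = record { complete = complete ; sound = sound }
    where
    -- Thresholds count elements from 1 and positions count from 0, so a bound by m + 1 on the
    -- element is a bound by m on the position.
    1+ : ∀ {m x} → m ℕ.≤ x → m + 1 ℕ.≤ suc x
    1+ {m} {x} m≤x = subst (ℕ._≤ suc x) (ℕP.+-comm 1 m) (ℕ.s≤s m≤x)
    1+⁻ : ∀ {m x} → m + 1 ℕ.≤ suc x → m ℕ.≤ x
    1+⁻ {m} {x} h = ℕP.≤-pred (subst (ℕ._≤ suc x) (ℕP.+-comm m 1) h)

    nonloop : ∀ i → ¬ T (isLoopᶜ (u i)) → l ℕ.≤ toℕ i
    nonloop i h with u i | stdView l k (toℕ i)
    ... | _ | loopᵛ _     = contradiction tt h
    ... | _ | classᵛ le _ = le
    ... | _ | freeᵛ le    = ℕP.≤-trans (ℕP.m≤m+n l k) le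

    nonloop⁻ : ∀ i → l ℕ.≤ toℕ i → ¬ T (isLoopᶜ (u i))
    nonloop⁻ i h with u i | stdView l k (toℕ i)
    ... | _ | loopᵛ lt   = λ _ → ℕP.<⇒≱ lt h
    ... | _ | classᵛ _ _ = λ ()
    ... | _ | freeᵛ _    = λ ()

    -- Two positions inside the class block would share the label 0. So either `i` is in the block
    -- and `j` has left it, or `i` is already past the block and `j` comes later still.
    late : ∀ i j → ¬ T (isLoopᶜ (u i)) → toℕ i ℕ.< toℕ j → cutLabel u i ≢ cutLabel u j → l + k ℕ.≤ toℕ j
    late i j h i<j ne with u i | stdView l k (toℕ i) | u j | stdView l k (toℕ j)
    ... | _ | loopᵛ _     | _ | _           = contradiction tt h
    ... | _ | classᵛ le _ | _ | loopᵛ lt    = contradiction (ℕP.<-trans i<j lt) (ℕP.≤⇒≯ le)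
    ... | _ | classᵛ _ _  | _ | classᵛ _ _  = contradiction refl ne
    ... | _ | classᵛ _ _  | _ | freeᵛ le    = le
    ... | _ | freeᵛ le    | _ | _           = ℕP.≤-trans le (ℕP.<⇒≤ i<j)

    ordered : ∀ {i j} → ¬ T (isLoopᶜ (u i)) → cutLabel u i ≢ cutLabel u j → toℕ i ℕ.< toℕ j → ⁅ i ⁆ ∪ ⁅ j ⁆ ∈ 𝓑
    ordered {i} {j} ¬Li ne i<j = ∈-schubertBases⁺ n _ _ i<j (1+ (nonloop i ¬Li)) (1+ (late i j ¬Li i<j ne))

    complete : ∀ {i j} → ¬ T (isLoopᶜ (u i)) → ¬ T (isLoopᶜ (u j)) → cutLabel u i ≢ cutLabel u j → ⁅ i ⁆ ∪ ⁅ j ⁆ ∈ 𝓑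
    complete {i} {j} ¬Li ¬Lj ne with ℕP.<-cmp (toℕ i) (toℕ j)
    ... | tri< i<j _ _ = ordered ¬Li ne i<j
    ... | tri≈ _ i≡j _ = contradiction (cong (cutLabel u) (FinP.toℕ-injective i≡j)) ne
    ... | tri> _ _ j<i = subst (_∈ 𝓑) (SubsetP.∪-comm ⁅ j ⁆ ⁅ i ⁆) (ordered ¬Lj (ne ∘ sym) j<i)

    -- Position `j` is free and has label `suc (toℕ j)`; an earlier `i` has label 0 or
    -- `suc (toℕ i)`.
    labels-differ : ∀ i j → toℕ i ℕ.< toℕ j → l + k ℕ.≤ toℕ j → cutLabel u i ≢ cutLabel u j
    labels-differ i j i<j le with u i | u j | stdView l k (toℕ j)
    ... | _      | _ | loopᵛ lt    = contradiction (ℕP.≤-trans (ℕP.m≤m+n l k) le) (ℕP.<⇒≱ lt)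
    ... | _      | _ | classᵛ _ lt = contradiction le (ℕP.<⇒≱ lt)
    ... | classᶜ | _ | freeᵛ _     = λ ()
    ... | loopᶜ  | _ | freeᵛ _     = ℕP.<⇒≢ (ℕ.s≤s i<j)
    ... | freeᶜ  | _ | freeᵛ _     = ℕP.<⇒≢ (ℕ.s≤s i<j)

    sound : ∀ {B} → B ∈ 𝓑 → ∃ λ i → ∃ λ j → ¬ T (isLoopᶜ (u i)) × ¬ T (isLoopᶜ (u j)) ×
                                     cutLabel u i ≢ cutLabel u j × B ≡ ⁅ i ⁆ ∪ ⁅ j ⁆
    sound B∈ =
      let (i , j , i<j , le₁ , le₂ , eq) = ∈-schubertBases⁻ n _ _ B∈
          l≤i   = 1+⁻ {l} le₁
          l+k≤j = 1+⁻ {l + k} le₂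
      in i , j , nonloop⁻ i l≤i , nonloop⁻ j (ℕP.≤-trans (ℕP.m≤m+n l k) l+k≤j) , labels-differ i j i<j l+k≤j , eq

  hull-schubert⇔cut : ∀ {y} → y ∈Hull (schubertPolytope n (l + 1) (l + k + 1)) ⇔ InCut u y
  hull-schubert⇔cut = mk⇔
    (partition⇒cut u ∘ hull⇒partitionPolytope schubert-across)
    (λ y∈ → partitionPolytope⇒hull schubert-across (cut⇒partition u y∈) n (cutLabel-≤ u))

-- Sorting a colouring

-- Two colourings that differ by a permutation of positions. The permutation is kept as data because
-- the symmetrized sum is reindexed along it.
record Matches {n} (u v : Fin n → Colour) : Set where
  constructor _matching_
  field
    perm  : Permutation′ n
    agree : ∀ i → u (perm ⟨$⟩ʳ i) ≡ v i

matches-trans : ∀ {n} {u v w : Fin n → Colour} → Matches u v → Matches v w → Matches u w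
matches-trans (π matching u≡v) (ρ matching v≡w) = (ρ ∘ₚ π) matching (λ i → trans (u≡v (ρ ⟨$⟩ʳ i)) (v≡w i))

matches-≗ : ∀ {n} {u v : Fin (suc n) → Colour} → u Fin.zero ≡ v Fin.zero →
  (∀ i → u (Fin.suc i) ≡ v (Fin.suc i)) → Matches u v
matches-≗ e es = Perm.id matching (λ { Fin.zero → e ; (Fin.suc i) → es i })

_◂_ : ∀ {n} → Colour → (Fin n → Colour) → Fin (suc n) → Colour
(c ◂ u) Fin.zero    = c
(c ◂ u) (Fin.suc i) = u i

matches-cons : ∀ {n} c {u v : Fin n → Colour} → Matches u v → Matches (c ◂ u) (c ◂ v)
matches-cons c (π matching u≡v) = Perm.lift₀ π matching (λ { Fin.zero → refl ; (Fin.suc i) → u≡v i })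

matches-swap : ∀ {n} c d (u : Fin n → Colour) → Matches (c ◂ (d ◂ u)) (d ◂ (c ◂ u))
matches-swap c d u = Perm.swap Perm.id matching (λ { Fin.zero → refl ; (Fin.suc Fin.zero) → refl ; (Fin.suc (Fin.suc i)) → refl })

std : ∀ {n} → ℕ → ℕ → Fin n → Colour
std l k i = stdColour l k (toℕ i)

-- One step of insertion sort: adjacent swaps carry the new element past the `l` loops to the head
-- of the class block. The bound on `l` says that all the loops are present among the `n` positions.
insert-class : ∀ n l k → l ℕ.≤ n → Matches {suc n} (classᶜ ◂ std l k) (std l (suc k))
insert-class n       zero    k _           = matches-≗ refl (λ _ → refl)
insert-class (suc n) (suc l) k (ℕ.s≤s l≤n) =
  matches-trans (matches-cons classᶜ {v = loopᶜ ◂ std l k} (matches-≗ refl (λ _ → refl)))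
  (matches-trans (matches-swap classᶜ loopᶜ (std l k))
  (matches-trans (matches-cons loopᶜ (insert-class n l k l≤n))
                 (matches-≗ refl (λ _ → refl))))

-- The same with a free element, which has to pass the loops and the class block; the bound ensures
-- that neither block is truncated.
insert-free : ∀ n l k → l + k ℕ.≤ n → Matches {suc n} (freeᶜ ◂ std l k) (std l k)
insert-free n       zero    zero    _         = matches-≗ refl (λ _ → refl)
insert-free (suc n) zero    (suc k) (ℕ.s≤s h) =
  matches-trans (matches-cons freeᶜ {v = classᶜ ◂ std zero k} (matches-≗ refl (λ _ → refl)))
  (matches-trans (matches-swap freeᶜ classᶜ (std zero k))
  (matches-trans (matches-cons classᶜ (insert-free n zero k h))
                 (matches-≗ refl (λ _ → refl))))
insert-free (suc n) (suc l) k       (ℕ.s≤s h) =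
  matches-trans (matches-cons freeᶜ {v = loopᶜ ◂ std l k} (matches-≗ refl (λ _ → refl)))
  (matches-trans (matches-swap freeᶜ loopᶜ (std l k))
  (matches-trans (matches-cons loopᶜ (insert-free n l k h))
                 (matches-≗ refl (λ _ → refl))))

count : ∀ {n} → (Fin n → Bool) → ℕ
count A = ∣ Vec.tabulate A ∣

-- Insertion sort, with the tail sorted first. The inequality is carried along because the insertion
-- lemmas ask for it.
sort : ∀ {n} (u : Fin n → Colour) →
  let l = count (isLoopᶜ ∘ u) ; k = count (isClassᶜ ∘ u) in
  l + k ℕ.≤ n × Matches u (std l k)
sort {zero}  u = ℕ.z≤n , Perm.id matching (λ ())
sort {suc n} u = extend (u Fin.zero) refl (sort (u ∘ Fin.suc))
  where
  l = count (isLoopᶜ ∘ u ∘ Fin.suc)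
  k = count (isClassᶜ ∘ u ∘ Fin.suc)

  cons : ∀ {c v} → u Fin.zero ≡ c → Matches (u ∘ Fin.suc) v → Matches u (c ◂ v)
  cons {c} {v} refl tail = matches-trans {v = c ◂ (u ∘ Fin.suc)}
    (matches-≗ refl (λ _ → refl)) (matches-cons c tail)

  extend : ∀ c → u Fin.zero ≡ c → l + k ℕ.≤ n × Matches (u ∘ Fin.suc) (std l k) →
    count (isLoopᶜ ∘ u) + count (isClassᶜ ∘ u) ℕ.≤ suc n ×
    Matches u (std (count (isLoopᶜ ∘ u)) (count (isClassᶜ ∘ u)))
  extend loopᶜ eq (le , tail) rewrite eq = ℕ.s≤s le , matches-trans (cons eq tail)
    (matches-≗ refl (λ _ → refl))
  extend classᶜ eq (le , tail) rewrite eq = ℕP.≤-trans (ℕP.≤-reflexive (ℕP.+-suc l k)) (ℕ.s≤s le) ,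
    matches-trans (cons eq tail) (insert-class n l k (ℕP.m+n≤o⇒m≤o l le))
  extend freeᶜ eq (le , tail) rewrite eq = ℕP.≤-trans le (ℕP.n≤1+n n) ,
    matches-trans (cons eq tail) (insert-free n l k le)

-- Permuting coordinates

sumFin-permute : ∀ {n} (π : Permutation′ n) (f : Fin n → ℚ) → sumFin (λ i → f (π ⟨$⟩ʳ i)) ≡ sumFin f
sumFin-permute {n} π f = trans (sumFin≡sum (λ i → f (π ⟨$⟩ʳ i))) (trans (sym (∑.sum-permute f π)) (sym (sumFin≡sum f)))
  where
  sumFin≡sum : ∀ {m} (f : Fin m → ℚ) → sumFin f ≡ ∑.sum f
  sumFin≡sum {zero}  f = refl
  sumFin≡sum {suc m} f = cong (f Fin.zero +ℚ_) (sumFin≡sum (f ∘ Fin.suc))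

cut-permute : ∀ {n} (π : Permutation′ n) {u v : Fin n → Colour} → (∀ i → u (π ⟨$⟩ʳ i) ≡ v i) →
  ∀ {y} → InCut v (act (π ⟨$⟩ʳ_) y) ⇔ InCut u y
cut-permute {n} π {u} {v} u≡v {y} = mk⇔
  (λ { (h , c) → let open InHypersimplex h in record
        { nonneg = λ i → subst (λ j → 0ℚ ≤ℚ y j) (Perm.inverseʳ π) (nonneg (π ⟨$⟩ˡ i))
        ; loop   = λ i Li → subst (λ j → y j ≡ 0ℚ) (Perm.inverseʳ π)
                     (loop (π ⟨$⟩ˡ i) (subst (T ∘ isLoopᶜ) (trans (cong u (sym (Perm.inverseʳ π))) (u≡v (π ⟨$⟩ˡ i))) Li))
        ; total  = trans (sym (sumFin-permute π y)) total
        ; entry≤ = λ i → subst (λ j → y j ≤ℚ 1ℚ) (Perm.inverseʳ π) (entry≤ (π ⟨$⟩ˡ i))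
        } , subst (_≤ℚ 1ℚ) mass≡ c })
  (λ { (h , c) → let open InHypersimplex h in record
        { nonneg = λ i → nonneg (π ⟨$⟩ʳ i)
        ; loop   = λ i Li → loop (π ⟨$⟩ʳ i) (subst (T ∘ isLoopᶜ) (sym (u≡v i)) Li)
        ; total  = trans (sumFin-permute π y) total
        ; entry≤ = λ i → entry≤ (π ⟨$⟩ʳ i)
        } , subst (_≤ℚ 1ℚ) (sym mass≡) c })
  where
  mass≡ : mass (isClassᶜ ∘ v) (act (π ⟨$⟩ʳ_) y) ≡ mass (isClassᶜ ∘ u) y
  mass≡ = trans (⟨⟩-congˡ (act (π ⟨$⟩ʳ_) y) (λ i → cong (bool→ℚ ∘ isClassᶜ) (sym (u≡v i))))
                  (sumFin-permute π (λ i → bool→ℚ (isClassᶜ (u i)) * y i))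

-- Enumerations without repetition

-- The map `g` recovers from an element the block that it comes from, so different blocks are
-- disjoint.
unique-concatMap : ∀ {A B : Set} (f : A → List B) (g : B → A) → (∀ {x y} → y ∈ f x → g y ≡ x) →
  (∀ x → Unique (f x)) → ∀ {xs} → Unique xs → Unique (concatMap f xs)
unique-concatMap f g g-inv f-unique {xs} xs-unique = UniqueP.concat⁺
  (AllP.map⁺ (All.universal f-unique xs))
  (AllPairsP.map⁺ (AllPairs.map (λ {x} {x′} x≢x′ {y} (y∈ , y∈′) → x≢x′ (trans (sym (g-inv y∈)) (g-inv y∈′))) xs-unique))

allSubsets-unique : ∀ n → Unique (allSubsets n)
allSubsets-unique zero    = All.[] ∷ []
allSubsets-unique (suc n) = unique-concatMap (λ s → (false ∷ s) ∷ (true ∷ s) ∷ []) Vec.tail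
  (λ { (here refl) → refl ; (there (here refl)) → refl })
  (λ s → ((λ ()) All.∷ All.[]) ∷ (All.[] ∷ []))
  (allSubsets-unique n)

allVecs-unique : ∀ n k → Unique (allVecs n k)
allVecs-unique n zero    = All.[] ∷ []
allVecs-unique n (suc k) = unique-concatMap (λ v → map (λ i → i ∷ v) (allFin n)) Vec.tail tail-inv
  (λ v → UniqueP.map⁺ VecP.∷-injectiveˡ (UniqueP.allFin⁺ n))
  (allVecs-unique n k)
  where
  tail-inv : ∀ {v w} → w ∈ map (λ i → i ∷ v) (allFin n) → Vec.tail w ≡ v
  tail-inv w∈ with ∈-map⁻ _ w∈
  ... | i , _ , refl = refl

allVecs-complete : ∀ {n k} (v : Vec.Vec (Fin n) k) → v ∈ allVecs n k
allVecs-complete []      = here refl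
allVecs-complete {n} (i ∷ v) = ∈-concatMap⁺ (λ v → map (λ i → i ∷ v) (allFin n))
  (lose (allVecs-complete v) (∈-map⁺ (λ i → i ∷ v) (∈-allFin i)))

any-finEqᵇ⁻ : ∀ {n k} (i : Fin n) (v : Vec.Vec (Fin n) k) → T (any (finEqᵇ i) (Vec.toList v)) → ∃ λ j → i ≡ Vec.lookup v j
any-finEqᵇ⁻ i (x ∷ v) t with Equivalence.to (T-∨ {finEqᵇ i x}) t
... | inj₁ e = Fin.zero , FinP.toℕ-injective (ℕP.≡ᵇ⇒≡ (toℕ i) (toℕ x) e)
... | inj₂ t′ with any-finEqᵇ⁻ i v t′
...   | j , e = Fin.suc j , e

any-finEqᵇ⁺ : ∀ {n k} (v : Vec.Vec (Fin n) k) j → T (any (finEqᵇ (Vec.lookup v j)) (Vec.toList v))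
any-finEqᵇ⁺ (x ∷ v) Fin.zero    = Equivalence.from (T-∨ {finEqᵇ x x}) (inj₁ (ℕP.≡⇒≡ᵇ (toℕ x) (toℕ x) refl))
any-finEqᵇ⁺ (x ∷ v) (Fin.suc j) = Equivalence.from (T-∨ {finEqᵇ (Vec.lookup v j) x}) (inj₂ (any-finEqᵇ⁺ v j))

InjectiveVec : ∀ {n k} → Vec.Vec (Fin n) k → Set
InjectiveVec v = ∀ {i j} → Vec.lookup v i ≡ Vec.lookup v j → i ≡ j

injectiveᵇ⁻ : ∀ {n k} (v : Vec.Vec (Fin n) k) → T (injectiveᵇ v) → InjectiveVec v
injectiveᵇ⁻ (x ∷ v) t {i} {j} e = go i j e
  where
  t₁ = proj₁ (Equivalence.to (T-∧ {not (any (finEqᵇ x) (Vec.toList v))}) t)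
  t₂ = proj₂ (Equivalence.to (T-∧ {not (any (finEqᵇ x) (Vec.toList v))}) t)
  fresh : ∀ j → x ≢ Vec.lookup v j
  fresh j refl = T-not⁻ t₁ (any-finEqᵇ⁺ v j)
  go : ∀ i j → Vec.lookup (x ∷ v) i ≡ Vec.lookup (x ∷ v) j → i ≡ j
  go Fin.zero    Fin.zero    e = refl
  go Fin.zero    (Fin.suc j) e = contradiction e (fresh j)
  go (Fin.suc i) Fin.zero    e = contradiction (sym e) (fresh i)
  go (Fin.suc i) (Fin.suc j) e = cong Fin.suc (injectiveᵇ⁻ v t₂ e)

injectiveᵇ⁺ : ∀ {n k} (v : Vec.Vec (Fin n) k) → InjectiveVec v → T (injectiveᵇ v)
injectiveᵇ⁺ []      inj = tt
injectiveᵇ⁺ (x ∷ v) inj = Equivalence.from (T-∧ {not (any (finEqᵇ x) (Vec.toList v))})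
  (T-not fresh , injectiveᵇ⁺ v (λ e → FinP.suc-injective (inj e)))
  where
  fresh : ¬ T (any (finEqᵇ x) (Vec.toList v))
  fresh t with any-finEqᵇ⁻ x v t
  ... | j , e with inj {Fin.zero} {Fin.suc j} e
  ...   | ()

sumℚ-↭ : ∀ {xs ys} → xs ↭ ys → sumℚ xs ≡ sumℚ ys
sumℚ-↭ ↭.refl                  = refl
sumℚ-↭ (↭.prep x p)            = cong (x +ℚ_) (sumℚ-↭ p)
sumℚ-↭ (↭.swap {ys = ys} x y p) = trans (cong (λ s → x +ℚ (y +ℚ s)) (sumℚ-↭ p)) (exch x y (sumℚ ys))
  where
  exch : ∀ x y s → x +ℚ (y +ℚ s) ≡ y +ℚ (x +ℚ s)
  exch = solve-∀ ℚ-ring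
sumℚ-↭ (↭.trans p q)           = trans (sumℚ-↭ p) (sumℚ-↭ q)

module _ {n} (π : Permutation′ n) where

  private
    tables : List (Vec.Vec (Fin n) n)
    tables = filterᵇ injectiveᵇ (allVecs n n)

    ∈-tables⁺ : ∀ v → InjectiveVec v → v ∈ tables
    ∈-tables⁺ v inj = ∈-filter⁺ (T? ∘ injectiveᵇ) (allVecs-complete v) (injectiveᵇ⁺ v inj)

    ∈-tables⁻ : ∀ v → v ∈ tables → InjectiveVec v
    ∈-tables⁻ v v∈ = injectiveᵇ⁻ v (proj₂ (∈-filter⁻ (T? ∘ injectiveᵇ) {xs = allVecs n n} v∈))

    tables-unique : Unique tables
    tables-unique = UniqueP.filter⁺ (T? ∘ injectiveᵇ) (allVecs-unique n n)

    precompose : (Fin n → Fin n) → Vec.Vec (Fin n) n → Vec.Vec (Fin n) n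
    precompose ρ v = Vec.tabulate (λ i → Vec.lookup v (ρ i))

    lookup-precompose : ∀ ρ v i → Vec.lookup (precompose ρ v) i ≡ Vec.lookup v (ρ i)
    lookup-precompose ρ v = VecP.lookup∘tabulate (λ i → Vec.lookup v (ρ i))

    precompose-inverse : ∀ (ρ τ : Fin n → Fin n) → (∀ i → τ (ρ i) ≡ i) → ∀ v → precompose ρ (precompose τ v) ≡ v
    precompose-inverse ρ τ inv v = trans
      (VecP.tabulate-cong (λ i → trans (lookup-precompose τ v (ρ i)) (cong (Vec.lookup v) (inv i))))
      (VecP.tabulate∘lookup v)

    precompose-injective : ∀ (ρ τ : Fin n → Fin n) → (∀ i → τ (ρ i) ≡ i) → ∀ v → InjectiveVec v → InjectiveVec (precompose ρ v)
    precompose-injective ρ τ inv v inj {i} {j} e = trans (sym (inv i)) (trans (cong τ ρi≡ρj) (inv j))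
      where
      ρi≡ρj : ρ i ≡ ρ j
      ρi≡ρj = inj (trans (sym (lookup-precompose ρ v i)) (trans e (lookup-precompose ρ v j)))

    r l : Fin n → Fin n
    r = π ⟨$⟩ʳ_
    l = π ⟨$⟩ˡ_

    -- Precomposition with a permutation has an inverse and preserves injectivity. Both lists are
    -- thus free of repetitions and have the same members, hence are rearrangements of each other.
    tables-↭ : map (precompose r) tables ↭ tables
    tables-↭ = ∼bag⇒↭ (unique∧set⇒bag
      (UniqueP.map⁺ (λ {v} {w} e → trans (sym (precompose-inverse l r (λ _ → Perm.inverseʳ π) v))
                                    (trans (cong (precompose l) e) (precompose-inverse l r (λ _ → Perm.inverseʳ π) w)))
                    tables-unique)
      tables-unique
      (mk⇔ to from))
      where
      to : ∀ {v} → v ∈ map (precompose r) tables → v ∈ tables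
      to v∈ with ∈-map⁻ (precompose r) v∈
      ... | w , w∈ , refl = ∈-tables⁺ (precompose r w) (precompose-injective r l (λ _ → Perm.inverseˡ π) w (∈-tables⁻ w w∈))
      from : ∀ {v} → v ∈ tables → v ∈ map (precompose r) tables
      from {v} v∈ = subst (_∈ map (precompose r) tables) (precompose-inverse r l (λ _ → Perm.inverseˡ π) v)
        (∈-map⁺ (precompose r) (∈-tables⁺ (precompose l v) (precompose-injective l r (λ _ → Perm.inverseʳ π) v (∈-tables⁻ v v∈))))

  -- Invariance of a sum over the symmetric group under translation. The maps `σ` and `τ` are
  -- related pointwise, since the permutations are functions read off from tables.
  sum-permutations-reindex : (F G : (Fin n → Fin n) → ℚ) →
    (∀ {σ τ} → (∀ i → σ i ≡ τ (π ⟨$⟩ʳ i)) → F σ ≡ G τ) →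
    sumℚ (map F (permutations n)) ≡ sumℚ (map G (permutations n))
  sum-permutations-reindex F G F≡G = begin
    sumℚ (map F (map Vec.lookup tables))                          ≡⟨ cong sumℚ (ListP.map-∘ tables) ⟨
    sumℚ (map (F ∘ Vec.lookup) tables)                            ≡⟨ sumℚ-↭ (↭P.map⁺ (F ∘ Vec.lookup) tables-↭) ⟨
    sumℚ (map (F ∘ Vec.lookup) (map (precompose r) tables))       ≡⟨ cong sumℚ (ListP.map-∘ tables) ⟨
    sumℚ (map (F ∘ Vec.lookup ∘ precompose r) tables)             ≡⟨ cong sumℚ (ListP.map-cong (λ v → F≡G (lookup-precompose r v)) tables) ⟩
    sumℚ (map (G ∘ Vec.lookup) tables)                            ≡⟨ cong sumℚ (ListP.map-∘ tables) ⟩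
    sumℚ (map G (map Vec.lookup tables))                          ∎
    where open ≡-Reasoning

-- Sums over lists

sumℚ-+ : ∀ {A : Set} (f g : A → ℚ) xs →
  sumℚ (map (λ x → f x +ℚ g x) xs) ≡ sumℚ (map f xs) +ℚ sumℚ (map g xs)
sumℚ-+ f g []       = sym (ℚP.+-identityˡ 0ℚ)
sumℚ-+ f g (x ∷ xs) = trans (cong (f x +ℚ g x +ℚ_) (sumℚ-+ f g xs)) (+-interchange (f x) (g x) _ _)

sumℚ-* : ∀ {A : Set} c (f : A → ℚ) xs → sumℚ (map (λ x → c * f x) xs) ≡ c * sumℚ (map f xs)
sumℚ-* c f []       = sym (ℚP.*-zeroʳ c)
sumℚ-* c f (x ∷ xs) = trans (cong (c * f x +ℚ_) (sumℚ-* c f xs)) (sym (ℚP.*-distribˡ-+ c (f x) _))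

sumℚ-0 : ∀ {A : Set} {f : A → ℚ} xs → (∀ x → x ∈ xs → f x ≡ 0ℚ) → sumℚ (map f xs) ≡ 0ℚ
sumℚ-0 []       h = refl
sumℚ-0 (x ∷ xs) h = trans (cong₂ _+ℚ_ (h x (here refl)) (sumℚ-0 xs (λ y y∈ → h y (there y∈)))) (ℚP.+-identityˡ 0ℚ)

sumℚ-cong : ∀ {A : Set} {f g : A → ℚ} xs → (∀ x → x ∈ xs → f x ≡ g x) → sumℚ (map f xs) ≡ sumℚ (map g xs)
sumℚ-cong []       h = refl
sumℚ-cong (x ∷ xs) h = cong₂ _+ℚ_ (h x (here refl)) (sumℚ-cong xs (λ y y∈ → h y (there y∈)))

sumℚ-comm : ∀ {A B : Set} (f : A → B → ℚ) xs ys →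
  sumℚ (map (λ x → sumℚ (map (f x) ys)) xs) ≡ sumℚ (map (λ y → sumℚ (map (λ x → f x y) xs)) ys)
sumℚ-comm f []       ys = sym (sumℚ-0 ys (λ _ _ → refl))
sumℚ-comm f (x ∷ xs) ys = trans (cong (sumℚ (map (f x) ys) +ℚ_) (sumℚ-comm f xs ys))
                                  (sym (sumℚ-+ (f x) (λ y → sumℚ (map (λ x → f x y) xs)) ys))

sumℚ-select : ∀ {A : Set} (h : A → ℚ) {a xs} → Unique xs → a ∈ xs → (∀ x → x ≢ a → h x ≡ 0ℚ) → sumℚ (map h xs) ≡ h a
sumℚ-select h {xs = a ∷ xs} (a∉ ∷ _) (here refl) off =
  trans (cong (h a +ℚ_) (sumℚ-0 xs (λ x x∈ → off x (λ { refl → All.lookup a∉ x∈ refl })))) (ℚP.+-identityʳ (h a))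
sumℚ-select h {xs = x ∷ xs} (x∉ ∷ uniq) (there a∈) off =
  trans (cong₂ _+ℚ_ (off x (All.lookup x∉ a∈)) (sumℚ-select h uniq a∈ off)) (ℚP.+-identityˡ _)

ℕ→ℚ-suc : ∀ m → ℕ→ℚ (suc m) ≡ 1ℚ +ℚ ℕ→ℚ m
ℕ→ℚ-suc m = sym (begin
  1ℚ +ℚ ℕ→ℚ m
    -- A fraction with denominator 1 is already reduced; in the form `mkℚ` the addition computes.
    ≡⟨ cong (1ℚ +ℚ_) (ℚP.normalize-coprime {m} {0} coprime) ⟩
  1ℚ +ℚ ℚ.mkℚ (ℤ.+ m) 0 coprime
    ≡⟨ cong (λ z → ((ℤ.+ 1) ℤ.+ z) ℚ./ 1) (ℤP.*-identityʳ (ℤ.+ m)) ⟩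
  ℕ→ℚ (suc m) ∎)
  where
  open ≡-Reasoning
  coprime : Coprime m 1
  coprime = Coprimality.sym (Coprimality.1-coprimeTo m)

-- Indicators

χ : ∀ {A : Set} → Dec A → ℚ
χ d = bool→ℚ (does d)

χ-yes : ∀ {A : Set} (d : Dec A) → A → χ d ≡ 1ℚ
χ-yes (yes _) a = refl
χ-yes (no ¬a) a = contradiction a ¬a

χ-no : ∀ {A : Set} (d : Dec A) → ¬ A → χ d ≡ 0ℚ
χ-no (yes a) ¬a = contradiction a ¬a
χ-no (no _)  ¬a = refl

χ-cong : ∀ {A B : Set} (d : Dec A) (e : Dec B) → A ⇔ B → χ d ≡ χ e
χ-cong (yes a) e A⇔B = sym (χ-yes e (Equivalence.to A⇔B a))
χ-cong (no ¬a) e A⇔B = sym (χ-no e (¬a ∘ Equivalence.from A⇔B))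

indicator≡χ : ∀ {n} (dec : HullDecider n) V y → indicator dec V y ≡ χ (dec V y)
indicator≡χ dec V y with dec V y
... | yes _ = refl
... | no  _ = refl

-- The pairwise condition allows at most one heavy member. With m members the right side is 1 - m +
-- m when all are light and 1 - m + (m - 1) when exactly one is heavy, which are the two values of
-- the left side.
χ-all-light : ∀ {A : Set} {Light : A → Set} (light? : ∀ P → Dec (Light P)) {Ps} →
  AllPairs (λ P Q → Light P ⊎ Light Q) Ps →
  χ (All.all? light? Ps) ≡ (1ℚ - ℕ→ℚ (length Ps)) +ℚ sumℚ (map (χ ∘ light?) Ps)
χ-all-light light? [] = refl
χ-all-light {Light = Light} light? {P ∷ Ps} (pairs ∷ rest) with light? P
... | yes _ = begin
  χ (All.all? light? Ps)
    ≡⟨ χ-all-light light? rest ⟩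
  (1ℚ - ℕ→ℚ (length Ps)) +ℚ S
    ≡⟨ shift (ℕ→ℚ (length Ps)) S ⟩
  (1ℚ - (1ℚ +ℚ ℕ→ℚ (length Ps))) +ℚ (1ℚ +ℚ S)
    ≡⟨ cong (λ m → (1ℚ - m) +ℚ (1ℚ +ℚ S)) (ℕ→ℚ-suc (length Ps)) ⟨
  (1ℚ - ℕ→ℚ (suc (length Ps))) +ℚ (1ℚ +ℚ S) ∎
  where
  open ≡-Reasoning
  S = sumℚ (map (χ ∘ light?) Ps)
  shift : ∀ m s → (1ℚ - m) +ℚ s ≡ (1ℚ - (1ℚ +ℚ m)) +ℚ (1ℚ +ℚ s)
  shift = solve-∀ ℚ-ring
... | no ¬p = begin
  0ℚ
    ≡⟨ cancel (ℕ→ℚ (length Ps)) ⟩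
  (1ℚ - (1ℚ +ℚ ℕ→ℚ (length Ps))) +ℚ (0ℚ +ℚ ℕ→ℚ (length Ps))
    ≡⟨ cong₂ (λ m s → (1ℚ - m) +ℚ (0ℚ +ℚ s)) (ℕ→ℚ-suc (length Ps)) (count-light Ps others) ⟨
  (1ℚ - ℕ→ℚ (suc (length Ps))) +ℚ (0ℚ +ℚ sumℚ (map (χ ∘ light?) Ps)) ∎
  where
  open ≡-Reasoning
  others : All Light Ps
  others = All.map [ (λ p → contradiction p ¬p) , (λ q → q) ]′ pairs
  count-light : ∀ Qs → All Light Qs → sumℚ (map (χ ∘ light?) Qs) ≡ ℕ→ℚ (length Qs)
  count-light []       []       = refl
  count-light (Q ∷ Qs) (q ∷ qs) = trans (cong₂ _+ℚ_ (χ-yes (light? Q) q) (count-light Qs qs)) (sym (ℕ→ℚ-suc (length Qs)))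
  cancel : ∀ m → 0ℚ ≡ (1ℚ - (1ℚ +ℚ m)) +ℚ (0ℚ +ℚ m)
  cancel = solve-∀ ℚ-ring

inHypersimplex? : ∀ {n} (L : Fin n → Bool) y → Dec (InHypersimplex L y)
inHypersimplex? L y = map′
  (λ (a , b , c , d) → record { nonneg = a ; loop = b ; total = c ; entry≤ = d })
  (λ h → let open InHypersimplex h in nonneg , loop , total , entry≤)
  (FinP.all? (λ i → 0ℚ ℚP.≤? y i) ×-dec
   FinP.all? (λ i → T? (L i) →-dec (y i ℚP.≟ 0ℚ)) ×-dec
   (sumFin y ℚP.≟ 2ℚ) ×-dec
   FinP.all? (λ i → y i ℚP.≤? 1ℚ))

inCut? : ∀ {n} (u : Fin n → Colour) y → Dec (InCut u y)
inCut? u y = inHypersimplex? (isLoopᶜ ∘ u) y ×-dec (mass (isClassᶜ ∘ u) y ℚP.≤? 1ℚ)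

hull-resp-≗ : ∀ {n} (V : List (Point n)) {y z} → (∀ i → y i ≡ z i) → y ∈Hull V → z ∈Hull V
hull-resp-≗ V y≗z (c , c≥0 , c-tot , c-com) = c , c≥0 , c-tot , λ i → trans (c-com i) (y≗z i)

-- Symmetrization makes the cut of a hypersimplex depend only on the numbers of loops and of class elements.
sum-cut≡sum-schubert : ∀ {n} (dec : HullDecider n) (x : Point n) (u : Fin n → Colour) {l k} →
  count (isLoopᶜ ∘ u) ≡ l → count (isClassᶜ ∘ u) ≡ k →
  sumℚ (map (λ σ → χ (inCut? u (act σ x))) (permutations n)) ≡
  sumℚ (map (λ σ → indicator dec (schubertPolytope n (l + 1) (l + k + 1)) (act σ x)) (permutations n))
sum-cut≡sum-schubert {n} dec x u {l} {k} refl refl = sym (sum-permutations-reindex perm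
  (λ σ → indicator dec S (act σ x)) (λ σ → χ (inCut? u (act σ x))) pointwise)
  where
  open Matches (proj₂ (sort u))
  S = schubertPolytope n (l + 1) (l + k + 1)
  pointwise : ∀ {σ τ} → (∀ i → σ i ≡ τ (perm ⟨$⟩ʳ i)) → indicator dec S (act σ x) ≡ χ (inCut? u (act τ x))
  pointwise {σ} {τ} σ≗τπ = trans (indicator≡χ dec S (act σ x)) (χ-cong (dec S (act σ x)) (inCut? u (act τ x)) (mk⇔
    (λ h → Equivalence.to (cut-permute perm agree)
             (Equivalence.to (hull-schubert⇔cut n l k) (hull-resp-≗ S (λ i → cong x (σ≗τπ i)) h)))
    (λ h → hull-resp-≗ S (λ i → cong x (sym (σ≗τπ i)))
             (Equivalence.from (hull-schubert⇔cut n l k) (Equivalence.from (cut-permute perm agree) h)))))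

-- Grouping the classes by size

length-filterᵇ-∷ : ∀ {A : Set} (p : A → Bool) x xs →
  ℕ→ℚ (length (filterᵇ p (x ∷ xs))) ≡ bool→ℚ (p x) +ℚ ℕ→ℚ (length (filterᵇ p xs))
length-filterᵇ-∷ p x xs with p x
... | true  = ℕ→ℚ-suc (length (filterᵇ p xs))
... | false = sym (ℚP.+-identityˡ (ℕ→ℚ (length (filterᵇ p xs))))

sum-filterᵇ-∷ : ∀ {A : Set} (f : A → ℚ) (p : A → Bool) x xs →
  sumℚ (map f (filterᵇ p (x ∷ xs))) ≡ bool→ℚ (p x) * f x +ℚ sumℚ (map f (filterᵇ p xs))
sum-filterᵇ-∷ f p x xs with p x
... | true  = cong (_+ℚ sumℚ (map f (filterᵇ p xs))) (sym (ℚP.*-identityˡ (f x)))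
... | false = trans (sym (ℚP.+-identityˡ _)) (cong (_+ℚ sumℚ (map f (filterᵇ p xs))) (sym (ℚP.*-zeroˡ (f x))))

-- Induction on the list: a set of size `a` adds one to the count for `k` equal to `a` and to no
-- other. The range runs from 2 to m - 1, so the size bound guarantees that every selected set is
-- counted.
sum-by-size : ∀ {n m} (A : ℕ → ℚ) (Ps : List (Subset n)) → All (λ P → ∣ P ∣ ℕ.< m) Ps →
  sumℚ (map (λ P → A ∣ P ∣) (filterᵇ (λ P → 2 ≤ᵇ ∣ P ∣) Ps)) ≡
  sumℚ (map (λ k → ℕ→ℚ (length (filterᵇ (λ P → ∣ P ∣ ≡ᵇ k) Ps)) * A k) (map (2 +_) (upTo (m ∸ 2))))
sum-by-size {m = m} A []       []           = sym (sumℚ-0 (map (2 +_) (upTo (m ∸ 2))) (λ k _ → ℚP.*-zeroˡ (A k)))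
sum-by-size {m = m} A (P ∷ Ps) (small ∷ smalls) = begin
  sumℚ (map (λ P → A ∣ P ∣) (filterᵇ (λ P → 2 ≤ᵇ ∣ P ∣) (P ∷ Ps)))
    ≡⟨ sum-filterᵇ-∷ (λ P → A ∣ P ∣) (λ P → 2 ≤ᵇ ∣ P ∣) P Ps ⟩
  bool→ℚ (2 ≤ᵇ a) * A a +ℚ sumℚ (map (λ P → A ∣ P ∣) (filterᵇ (λ P → 2 ≤ᵇ ∣ P ∣) Ps))
    ≡⟨ cong₂ _+ℚ_ (sym selected) (sum-by-size A Ps smalls) ⟩
  sumℚ (map (λ k → bool→ℚ (a ≡ᵇ k) * A k) ks) +ℚ sumℚ (map (λ k → N k * A k) ks)
    ≡⟨ sumℚ-+ (λ k → bool→ℚ (a ≡ᵇ k) * A k) (λ k → N k * A k) ks ⟨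
  sumℚ (map (λ k → bool→ℚ (a ≡ᵇ k) * A k +ℚ N k * A k) ks)
    ≡⟨ sumℚ-cong ks (λ k _ → trans (sym (ℚP.*-distribʳ-+ (A k) (bool→ℚ (a ≡ᵇ k)) (N k)))
                                 (cong (_* A k) (sym (length-filterᵇ-∷ (λ P → ∣ P ∣ ≡ᵇ k) P Ps)))) ⟩
  sumℚ (map (λ k → ℕ→ℚ (length (filterᵇ (λ P → ∣ P ∣ ≡ᵇ k) (P ∷ Ps))) * A k) ks) ∎
  where
  open ≡-Reasoning
  a  = ∣ P ∣
  ks = map (2 +_) (upTo (m ∸ 2))
  N : ℕ → ℚ
  N k = ℕ→ℚ (length (filterᵇ (λ P → ∣ P ∣ ≡ᵇ k) Ps))

  off : ∀ k → a ≢ k → bool→ℚ (a ≡ᵇ k) * A k ≡ 0ℚ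
  off k a≢k = trans (cong (λ b → bool→ℚ b * A k) (¬T⇒≡ (a≢k ∘ ℕP.≡ᵇ⇒≡ a k))) (ℚP.*-zeroˡ (A k))

  -- Sets of size 0 or 1 are dropped on both sides: by the filter on the right, and on the left
  -- because the range starts at 2.
  selected : sumℚ (map (λ k → bool→ℚ (a ≡ᵇ k) * A k) ks) ≡ bool→ℚ (2 ≤ᵇ a) * A a
  selected with 2 ℕP.≤? a
  ... | yes 2≤a = trans
    (sumℚ-select (λ k → bool→ℚ (a ≡ᵇ k) * A k) (UniqueP.map⁺ (ℕP.+-cancelˡ-≡ 2 _ _) (UniqueP.upTo⁺ (m ∸ 2))) a∈ks
      (λ k k≢a → off k (k≢a ∘ sym)))
    (cong (λ b → bool→ℚ b * A a) (trans (T⇒≡ (ℕP.≡⇒≡ᵇ a a refl)) (sym (T⇒≡ (ℕP.≤⇒≤ᵇ 2≤a)))))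
    where
    a∈ks : a ∈ ks
    a∈ks = subst (_∈ ks) (ℕP.m+[n∸m]≡n 2≤a) (∈-map⁺ (2 +_) (∈-upTo⁺ (ℕP.∸-monoˡ-< small 2≤a)))
  ... | no 2≰a = trans
    (sumℚ-0 ks (λ k k∈ → off k (λ { refl → 2≰a (2≤k k∈) })))
    (trans (sym (ℚP.*-zeroˡ (A a))) (cong (λ b → bool→ℚ b * A a) (sym (¬T⇒≡ (2≰a ∘ ℕP.≤ᵇ⇒≤ 2 a)))))
    where
    2≤k : ∀ {k} → k ∈ ks → 2 ℕ.≤ k
    2≤k k∈ with ∈-map⁻ (2 +_) k∈
    ... | j , _ , refl = ℕP.m≤m+n 2 j

unique⇒allPairs : ∀ {A : Set} {R : A → A → Set} {xs} → (∀ {x y} → x ∈ xs → y ∈ xs → x ≢ y → R x y) →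
  Unique xs → AllPairs R xs
unique⇒allPairs h []            = []
unique⇒allPairs h (x∉ ∷ unique) =
  All.tabulate (λ y∈ → h (here refl) (there y∈) (All.lookup x∉ y∈)) ∷
  unique⇒allPairs (λ x∈ y∈ → h (there x∈) (there y∈)) unique

colour : Bool → Bool → Colour
colour isLoop inClass = if isLoop then loopᶜ else if inClass then classᶜ else freeᶜ

isLoop-colour : ∀ a b → isLoopᶜ (colour a b) ≡ a
isLoop-colour true  _     = refl
isLoop-colour false true  = refl
isLoop-colour false false = refl

isClass-colour : ∀ a b → isClassᶜ (colour a b) ≡ not a ∧ b
isClass-colour true  _     = refl
isClass-colour false true  = refl
isClass-colour false false = refl

massOf : ∀ {n} → Subset n → Point n → ℚ
massOf P = mass (λ i → memᵇ i P)

disjoint-light : ∀ {n} {L : Fin n → Bool} {y} → InHypersimplex L y → ∀ {P Q} →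
  (∀ k → T (memᵇ k P) → ¬ T (memᵇ k Q)) → massOf P y ≤ℚ 1ℚ ⊎ massOf Q y ≤ℚ 1ℚ
disjoint-light {y = y} h {P} {Q} disjoint with massOf P y ℚP.≤? 1ℚ | massOf Q y ℚP.≤? 1ℚ
... | yes p | _     = inj₁ p
... | no _  | yes q = inj₂ q
... | no ¬p | no ¬q = contradiction (ℚP.+-mono-< (ℚP.≰⇒> ¬p) (ℚP.≰⇒> ¬q))
  (λ 2<sum → ℚP.<-irrefl refl (ℚP.<-≤-trans 2<sum sum≤2))
  where
  open InHypersimplex h
  share : ∀ a b t → 0ℚ ≤ℚ t → (T a → ¬ T b) → (bool→ℚ a +ℚ bool→ℚ b) * t ≤ℚ t
  share true  true  t t≥0 h = contradiction tt (h tt)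
  share true  false t t≥0 h = ℚP.≤-reflexive (ℚP.*-identityˡ t)
  share false true  t t≥0 h = ℚP.≤-reflexive (ℚP.*-identityˡ t)
  share false false t t≥0 h = subst (_≤ℚ t) (sym (ℚP.*-zeroˡ t)) t≥0
  sum≤2 : massOf P y +ℚ massOf Q y ≤ℚ 2ℚ
  sum≤2 = subst₂ _≤ℚ_ (⟨⟩-+ˡ (λ i → bool→ℚ (memᵇ i P)) (λ i → bool→ℚ (memᵇ i Q)) y) total
    (sumFin-mono (λ i → share (memᵇ i P) (memᵇ i Q) (y i) (nonneg i) (disjoint i)))

-- The base polytope as a multiply cut hypersimplex

module BasePolytope {n} (M : Matroid n) (r2 : HasRank2 M) where
  open Rank2 M r2

  colouring : Subset n → Fin n → Colour
  colouring P i = colour (L i) (memᵇ i P)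

  isLoop-colouring : ∀ P i → isLoopᶜ (colouring P i) ≡ L i
  isLoop-colouring P i = isLoop-colour (L i) (memᵇ i P)

  isClass-colouring : ∀ P i → isClassᶜ (colouring P i) ≡ not (L i) ∧ memᵇ i P
  isClass-colouring P i = isClass-colour (L i) (memᵇ i P)

  count-loops : ∀ P → count (isLoopᶜ ∘ colouring P) ≡ numLoops M
  count-loops P = cong ∣_∣ (trans (VecP.tabulate-cong (isLoop-colouring P)) (VecP.tabulate∘lookup (loops M)))

  count-class : ∀ P → (∀ i → T (memᵇ i P) → ¬ T (L i)) → count (isClassᶜ ∘ colouring P) ≡ ∣ P ∣
  count-class P P#L = cong ∣_∣ (trans (VecP.tabulate-cong same) (VecP.tabulate∘lookup P))
    where
    same : ∀ i → isClassᶜ (colouring P i) ≡ memᵇ i P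
    same i = trans (isClass-colouring P i) (absorb (L i) (memᵇ i P) (P#L i))
      where
      absorb : ∀ a b → (T b → ¬ T a) → not a ∧ b ≡ b
      absorb true  true  h = contradiction tt (h tt)
      absorb true  false h = refl
      absorb false b     h = refl

  -- The colour of a loop takes precedence over that of `P`, so only nonloops of `P` count towards
  -- the cut; the loops in `P` have entry zero and the two masses agree.
  cut⇔light : ∀ P {y} → InCut (colouring P) y ⇔ (InHypersimplex L y × massOf P y ≤ℚ 1ℚ)
  cut⇔light P {y} = mk⇔ to from
    where
    to : InCut (colouring P) y → InHypersimplex L y × massOf P y ≤ℚ 1ℚ
    to (h , c) = record { nonneg = nonneg ; total = total ; entry≤ = entry≤
                        ; loop = λ i Li → loop i (subst T (sym (isLoop-colouring P i)) Li) }
               , ℚP.≤-trans (mass-mono nonneg split) c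
      where
      open InHypersimplex h
      split : ∀ i → T (memᵇ i P) → T (isClassᶜ (colouring P i)) ⊎ y i ≡ 0ℚ
      split i i∈P = by-loop (T? (L i))
        where
        by-loop : Dec (T (L i)) → T (isClassᶜ (colouring P i)) ⊎ y i ≡ 0ℚ
        by-loop (yes Li) = inj₂ (loop i (subst T (sym (isLoop-colouring P i)) Li))
        by-loop (no ¬Li) = inj₁ (subst T (sym (isClass-colouring P i))
          (Equivalence.from (T-∧ {not (L i)} {memᵇ i P}) (T-not ¬Li , i∈P)))
    from : InHypersimplex L y × massOf P y ≤ℚ 1ℚ → InCut (colouring P) y
    from (h , c) = record { nonneg = nonneg ; total = total ; entry≤ = entry≤
                          ; loop = λ i Li → loop i (subst T (isLoop-colouring P i) Li) }
                 , ℚP.≤-trans (mass-mono nonneg (λ i t → inj₁ (proj₂ (Equivalence.to (T-∧ {not (L i)} {memᵇ i P}) (subst T (isClass-colouring P i) t))))) c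
      where open InHypersimplex h

  bigClasses : List (Subset n)
  bigClasses = filterᵇ (λ P → 2 ≤ᵇ ∣ P ∣) (parallelClasses M)

  bigClass⇒class : ∀ {P} → P ∈ bigClasses → ∃ λ i → ¬ T (L i) × P ≡ class i
  bigClass⇒class P∈ = ∈-parallelClasses⁻ (proj₁ (∈-filter⁻ (λ P → T? (2 ≤ᵇ ∣ P ∣)) {xs = parallelClasses M} P∈))

  -- The fibres of `label` among the nonloops are the parallel classes. Those of size 1 are
  -- controlled by the bound on single entries, so only the big ones remain as conditions.
  hull⇔light : ∀ {y} → y ∈Hull basePolytope M ⇔ (InHypersimplex L y × All (λ P → massOf P y ≤ℚ 1ℚ) bigClasses)
  hull⇔light {y} = mk⇔ to from
    where
    to : y ∈Hull basePolytope M → InHypersimplex L y × All (λ P → massOf P y ≤ℚ 1ℚ) bigClasses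
    to h = partition⇒hypersimplex y∈ , All.tabulate light
      where
      y∈ = hull⇒partitionPolytope bases-across h
      open InPartitionPolytope y∈
      same-label : ∀ i k → T (memᵇ k (class i)) → T (label k ≡ᵇ label i) ⊎ y k ≡ 0ℚ
      same-label i k k∈ = inj₁ (ℕP.≡⇒≡ᵇ (label k) (label i) (sym (label-≡⁺ (subst T (memᵇ-class i k) k∈))))
      light : ∀ {P} → P ∈ bigClasses → massOf P y ≤ℚ 1ℚ
      light P∈ = let (i , _ , eq) = bigClass⇒class P∈ in
        subst (λ P → massOf P y ≤ℚ 1ℚ) (sym eq) (ℚP.≤-trans (mass-mono nonneg (same-label i)) (class≤ (label i)))
    from : InHypersimplex L y × All (λ P → massOf P y ≤ℚ 1ℚ) bigClasses → y ∈Hull basePolytope M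
    from (h , lights) = partitionPolytope⇒hull bases-across
      (record { nonneg = nonneg ; loop = loop ; total = total ; class≤ = class≤ }) n (λ i → first-≤ (parallel i))
      where
      open InHypersimplex h
      unique : ∀ i → ¬ 2 ℕ.≤ ∣ class i ∣ → ∀ a b → T (memᵇ a (class i)) → T (memᵇ b (class i)) → a ≡ b
      unique i 2≰ a b a∈ b∈ = decidable-stable (a Fin.≟ b) (λ a≢b → 2≰ (distinct⇒2≤∣∣ {p = class i} a≢b (memᵇ⇒∈ a∈) (memᵇ⇒∈ b∈)))
      class-light : ∀ i → ¬ T (L i) → massOf (class i) y ≤ℚ 1ℚ
      class-light i ¬Li = by-size (2 ℕP.≤? ∣ class i ∣)
        where
        by-size : Dec (2 ℕ.≤ ∣ class i ∣) → massOf (class i) y ≤ℚ 1ℚ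
        by-size (yes 2≤) = All.lookup lights (∈-filter⁺ (λ P → T? (2 ≤ᵇ ∣ P ∣)) (∈-parallelClasses⁺ ¬Li) (ℕP.≤⇒≤ᵇ 2≤))
        by-size (no 2≰)  = mass≤1-subsingleton entry≤ (unique i 2≰)
      class≤ : ∀ a → mass (λ i → label i ≡ᵇ a) y ≤ℚ 1ℚ
      class≤ a = by-label (FinP.any? (λ i → T? (not (L i) ∧ (label i ≡ᵇ a))))
        where
        by-label : Dec (∃ λ i → T (not (L i) ∧ (label i ≡ᵇ a))) → mass (λ i → label i ≡ᵇ a) y ≤ℚ 1ℚ
        -- Here the label `a` is carried by loops only, as for `a` equal to `n`, or by nothing; the
        -- mass is 0.
        by-label (no ∄i) = ℚP.≤-trans (mass-mono {B = λ _ → false} nonneg only-loops)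
          (subst (_≤ℚ 1ℚ) (sym (mass-empty {A = λ _ → false} y (λ _ ()))) (ℚP.nonNegative⁻¹ 1ℚ))
          where
          only-loops : ∀ k → T (label k ≡ᵇ a) → ⊥ ⊎ y k ≡ 0ℚ
          only-loops k lk≡a = inj₂ (loop k (decidable-stable (T? (L k))
            (λ ¬Lk → ∄i (k , Equivalence.from (T-∧ {not (L k)} {label k ≡ᵇ a}) (T-not ¬Lk , lk≡a)))))
        by-label (yes (i , t)) = ℚP.≤-trans (mass-mono nonneg (λ k → in-class k (T? (L k)))) (class-light i ¬Li)
          where
          ¬Li = T-not⁻ (proj₁ (Equivalence.to (T-∧ {not (L i)} {label i ≡ᵇ a}) t))
          li≡a = ℕP.≡ᵇ⇒≡ (label i) a (proj₂ (Equivalence.to (T-∧ {not (L i)} {label i ≡ᵇ a}) t))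
          in-class : ∀ k → Dec (T (L k)) → T (label k ≡ᵇ a) → T (memᵇ k (class i)) ⊎ y k ≡ 0ℚ
          in-class k (yes Lk) lk≡a = inj₂ (loop k Lk)
          in-class k (no ¬Lk) lk≡a = inj₁ (subst T (sym (memᵇ-class i k))
            (label-≡⁻ ¬Li ¬Lk (trans li≡a (sym (ℕP.≡ᵇ⇒≡ (label k) a lk≡a)))))

  -- Absence of repetitions matters: a heavy class listed twice would violate the pairwise
  -- condition.
  bigClasses-light : ∀ {y} → InHypersimplex L y → AllPairs (λ P Q → massOf P y ≤ℚ 1ℚ ⊎ massOf Q y ≤ℚ 1ℚ) bigClasses
  bigClasses-light {y} h = unique⇒allPairs light-pair
    (UniqueP.filter⁺ (λ P → T? (2 ≤ᵇ ∣ P ∣)) (UniqueP.filter⁺ (T? ∘ isParallelClassᵇ M) (allSubsets-unique n)))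
    where
    open InHypersimplex h
    disjoint : ∀ {P Q} → P ∈ bigClasses → Q ∈ bigClasses → P ≢ Q → ∀ k → T (memᵇ k P) → ¬ T (memᵇ k Q)
    disjoint P∈ Q∈ P≢Q k k∈P k∈Q =
      let (i , _ , P≡) = bigClass⇒class P∈
          (j , _ , Q≡) = bigClass⇒class Q∈
          ik = subst T (trans (cong (memᵇ k) P≡) (memᵇ-class i k)) k∈P
          jk = subst T (trans (cong (memᵇ k) Q≡) (memᵇ-class j k)) k∈Q
      in P≢Q (trans P≡ (trans (class-cong (parallel-trans ik (parallel-sym jk))) (sym Q≡)))
    light-pair : ∀ {P Q} → P ∈ bigClasses → Q ∈ bigClasses → P ≢ Q → massOf P y ≤ℚ 1ℚ ⊎ massOf Q y ≤ℚ 1ℚ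
    light-pair {P} {Q} P∈ Q∈ P≢Q = disjoint-light h {P} {Q} (disjoint P∈ Q∈ P≢Q)

  nonloop : ∃ λ i → ¬ T (L i)
  nonloop = let (i , _ , b , _) = ∈-bases-pair (∈-bases⁺ (proj₂ (Matroid.nonempty M))) in i , base⇒nonloop b

  -- An artificial class of size 1 whose cut is always satisfied: it turns the uncut hypersimplex
  -- into a cut one, so that the term with coefficient 1 - p is symmetrized like the others. It has
  -- to be a nonloop for its class colour to be counted once.
  point : Subset n
  point = ⁅ proj₁ nonloop ⁆

  ∈-point : ∀ {i} → T (memᵇ i point) → i ≡ proj₁ nonloop
  ∈-point i∈ = SubsetP.x∈⁅y⁆⇒x≡y (proj₁ nonloop) (memᵇ⇒∈ i∈)

  cutχ : Subset n → Point n → ℚ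
  cutχ P y = χ (inCut? (colouring P) y)

  module _ (dec : HullDecider n) (y : Point n) where

    private
      p = ℕ→ℚ (numBigClasses M)

      light? : ∀ P → Dec (massOf P y ≤ℚ 1ℚ)
      light? P = massOf P y ℚP.≤? 1ℚ

      -- On the hypersimplex every cut indicator reduces to lightness of one set, and `cutχ point`
      -- is 1, so the counting identity for light sets applies.
      inside : InHypersimplex L y →
        χ (dec (basePolytope M) y) ≡ (1ℚ - p) * cutχ point y +ℚ sumℚ (map (λ P → cutχ P y) bigClasses)
      inside h = begin
        χ (dec (basePolytope M) y)
          ≡⟨ χ-cong (dec (basePolytope M) y) (All.all? light? bigClasses)
               (mk⇔ (λ v → proj₂ (Equivalence.to hull⇔light v)) (λ v → Equivalence.from hull⇔light (h , v))) ⟩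
        χ (All.all? light? bigClasses)
          ≡⟨ χ-all-light light? (bigClasses-light h) ⟩
        (1ℚ - p) +ℚ sumℚ (map (χ ∘ light?) bigClasses)
          ≡⟨ cong₂ _+ℚ_
               (trans (sym (ℚP.*-identityʳ (1ℚ - p))) (cong ((1ℚ - p) *_) (sym (χ-yes (inCut? (colouring point) y) point-cut))))
               (sumℚ-cong bigClasses (λ P _ → χ-cong (light? P) (inCut? (colouring P) y)
                 (mk⇔ (λ v → Equivalence.from (cut⇔light P) (h , v)) (λ v → proj₂ (Equivalence.to (cut⇔light P) v))))) ⟩
        (1ℚ - p) * cutχ point y +ℚ sumℚ (map (λ P → cutχ P y) bigClasses) ∎
        where
        open ≡-Reasoning
        point-cut : InCut (colouring point) y
        point-cut = Equivalence.from (cut⇔light point)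
          (h , mass≤1-subsingleton (InHypersimplex.entry≤ h) (λ i j i∈ j∈ → trans (∈-point i∈) (sym (∈-point j∈))))

      -- All terms vanish here, including the one with coefficient 1 - p, because that coefficient
      -- multiplies `cutχ point` and does not stand alone.
      outside : ¬ InHypersimplex L y →
        χ (dec (basePolytope M) y) ≡ (1ℚ - p) * cutχ point y +ℚ sumℚ (map (λ P → cutχ P y) bigClasses)
      outside ¬h = begin
        χ (dec (basePolytope M) y)
          ≡⟨ χ-no (dec (basePolytope M) y) (λ v → ¬h (proj₁ (Equivalence.to hull⇔light v))) ⟩
        0ℚ
          ≡⟨ cong (_+ℚ 0ℚ) (ℚP.*-zeroʳ (1ℚ - p)) ⟨
        (1ℚ - p) * 0ℚ +ℚ 0ℚ
          ≡⟨ cong₂ (λ s t → (1ℚ - p) * s +ℚ t) (cut-zero point) (sumℚ-0 bigClasses (λ P _ → cut-zero P)) ⟨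
        (1ℚ - p) * cutχ point y +ℚ sumℚ (map (λ P → cutχ P y) bigClasses) ∎
        where
        open ≡-Reasoning
        cut-zero : ∀ P → cutχ P y ≡ 0ℚ
        cut-zero P = χ-no (inCut? (colouring P) y) (λ v → ¬h (proj₁ (Equivalence.to (cut⇔light P) v)))

    indicator-basePolytope :
      indicator dec (basePolytope M) y ≡ (1ℚ - p) * cutχ point y +ℚ sumℚ (map (λ P → cutχ P y) bigClasses)
    indicator-basePolytope = trans (indicator≡χ dec (basePolytope M) y) (by-membership (inHypersimplex? L y))
      where
      by-membership : Dec (InHypersimplex L y) →
        χ (dec (basePolytope M) y) ≡ (1ℚ - p) * cutχ point y +ℚ sumℚ (map (λ P → cutχ P y) bigClasses)
      by-membership (yes h) = inside h
      by-membership (no ¬h) = outside ¬h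

  module _ (dec : HullDecider n) (x : Point n) where

    -- The symmetrized indicator before division by the factorial, which is a common factor restored
    -- only at the end.
    schubertSum : ℕ → ℚ
    schubertSum k = sumℚ (map (λ σ → indicator dec (schubertPolytope n (numLoops M + 1) (numLoops M + k + 1)) (act σ x))
                              (permutations n))

    sum-cutχ : ∀ P → (∀ i → T (memᵇ i P) → ¬ T (L i)) →
      sumℚ (map (λ σ → cutχ P (act σ x)) (permutations n)) ≡ schubertSum ∣ P ∣
    sum-cutχ P P#L = sum-cut≡sum-schubert dec x (colouring P) (count-loops P) (count-class P P#L)

    sum-cutχ-point : sumℚ (map (λ σ → cutχ point (act σ x)) (permutations n)) ≡ schubertSum 1
    sum-cutχ-point = trans
      (sum-cutχ point (λ i i∈ → subst (λ j → ¬ T (L j)) (sym (∈-point i∈)) (proj₂ nonloop)))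
      (cong schubertSum (SubsetP.∣⁅x⁆∣≡1 (proj₁ nonloop)))

    sum-cutχ-class : ∀ P → P ∈ bigClasses → sumℚ (map (λ σ → cutχ P (act σ x)) (permutations n)) ≡ schubertSum ∣ P ∣
    sum-cutχ-class P P∈ = sum-cutχ P (λ k k∈ →
      let (i , _ , P≡) = bigClass⇒class P∈
      in proj₁ (proj₂ (parallel⁻ i k (subst T (trans (cong (memᵇ k) P≡) (memᵇ-class i k)) k∈))))

    classes-small : All (λ P → ∣ P ∣ ℕ.< n) (parallelClasses M)
    classes-small = All.tabulate (λ P∈ →
      let (i , _ , P≡) = ∈-parallelClasses⁻ P∈ in subst (λ P → ∣ P ∣ ℕ.< n) (sym P≡) (∣class∣<n i))

    sum-indicator-basePolytope :
      sumℚ (map (λ σ → indicator dec (basePolytope M) (act σ x)) (permutations n)) ≡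
      (1ℚ - ℕ→ℚ (numBigClasses M)) * schubertSum 1
        +ℚ sumℚ (map (λ k → ℕ→ℚ (numClasses M k) * schubertSum k) (map (2 +_) (upTo (n ∸ 2))))
    sum-indicator-basePolytope = begin
      sumℚ (map (λ σ → indicator dec (basePolytope M) (act σ x)) Sₙ)
        ≡⟨ sumℚ-cong Sₙ (λ σ _ → indicator-basePolytope dec (act σ x)) ⟩
      sumℚ (map (λ σ → q * cutχ point (act σ x) +ℚ sumℚ (map (λ P → cutχ P (act σ x)) bigClasses)) Sₙ)
        ≡⟨ sumℚ-+ (λ σ → q * cutχ point (act σ x)) (λ σ → sumℚ (map (λ P → cutχ P (act σ x)) bigClasses)) Sₙ ⟩
      sumℚ (map (λ σ → q * cutχ point (act σ x)) Sₙ)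
        +ℚ sumℚ (map (λ σ → sumℚ (map (λ P → cutχ P (act σ x)) bigClasses)) Sₙ)
        ≡⟨ cong₂ _+ℚ_ (sumℚ-* q (λ σ → cutχ point (act σ x)) Sₙ) (sumℚ-comm (λ σ P → cutχ P (act σ x)) Sₙ bigClasses) ⟩
      q * sumℚ (map (λ σ → cutχ point (act σ x)) Sₙ)
        +ℚ sumℚ (map (λ P → sumℚ (map (λ σ → cutχ P (act σ x)) Sₙ)) bigClasses)
        ≡⟨ cong₂ (λ s t → q * s +ℚ t) sum-cutχ-point (sumℚ-cong bigClasses sum-cutχ-class) ⟩
      q * schubertSum 1 +ℚ sumℚ (map (λ P → schubertSum ∣ P ∣) bigClasses)
        ≡⟨ cong (q * schubertSum 1 +ℚ_) (sum-by-size schubertSum (parallelClasses M) classes-small) ⟩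
      q * schubertSum 1 +ℚ sumℚ (map (λ k → ℕ→ℚ (numClasses M k) * schubertSum k) (map (2 +_) (upTo (n ∸ 2)))) ∎
      where
      open ≡-Reasoning
      Sₙ = permutations n
      q  = 1ℚ - ℕ→ℚ (numBigClasses M)

theorem3p5 : (n : ℕ) (M : Matroid n) → HasRank2 M →
    (dec : HullDecider n) (x : Point n) →
    symIndicator dec (basePolytope M) x ≡
    ((1ℚ - ℕ→ℚ (numBigClasses M)) * symIndicator dec (schubertPolytope n (numLoops M + 1) (numLoops M + 2)) x)
    Data.Rational.+ sumℚ (map (λ k → ℕ→ℚ (numClasses M k) * symIndicator dec (schubertPolytope n (numLoops M + 1) (numLoops M + k + 1)) x)
    (map (2 +_) (upTo (n ∸ 2))))
theorem3p5 n M r2 dec x = begin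
  c * sumℚ (map (λ σ → indicator dec (basePolytope M) (act σ x)) (permutations n))
    ≡⟨ cong (c *_) (sum-indicator-basePolytope dec x) ⟩
  c * (q * A 1 +ℚ sumℚ (map (λ k → N k * A k) ks))
    ≡⟨ ℚP.*-distribˡ-+ c _ _ ⟩
  c * (q * A 1) +ℚ c * sumℚ (map (λ k → N k * A k) ks)
    ≡⟨ cong₂ _+ℚ_ (*-exchange c q (A 1)) (sym (sumℚ-* c (λ k → N k * A k) ks)) ⟩
  q * (c * A 1) +ℚ sumℚ (map (λ k → c * (N k * A k)) ks)
    ≡⟨ cong₂ (λ s t → q * s +ℚ t)
         -- The class of size 1 gives the threshold `numLoops M + 1 + 1`, to be read as
         -- `numLoops M + 2`.
         (cong (λ x₂ → symIndicator dec (schubertPolytope n (numLoops M + 1) x₂) x) (ℕP.+-assoc (numLoops M) 1 1))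
         (sumℚ-cong ks (λ k _ → *-exchange c (N k) (A k))) ⟩
  q * symIndicator dec (schubertPolytope n (numLoops M + 1) (numLoops M + 2)) x
    +ℚ sumℚ (map (λ k → N k * (c * A k)) ks) ∎
  where
  open ≡-Reasoning
  open BasePolytope M r2
  c  = (ℤ.+ 1 ℚ./ (n ℕ.!)) {{n ℕP.!≢0}}
  q  = 1ℚ - ℕ→ℚ (numBigClasses M)
  A  = schubertSum dec x
  N : ℕ → ℚ
  N k = ℕ→ℚ (numClasses M k)
  ks = map (2 +_) (upTo (n ∸ 2))
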